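{- Let $n\geq 4$ and $2\leq k\leq\lfloor n/2\rfloor$, and let $G_{n,k}^{C}$ be the flip graph of $k$-element subsets of $[n]$ (defined in the context). Then: (i) if $n$ is even, then $G_{n,k}^{C}$ has no rainbow cycle; (ii) if $n$ is odd and $k=2$, then $G_{n,2}^{C}$ has a rainbow Hamilton cycle; (iii) if $n$ is odd and $k=2$, then $G_{n,2}^{C}$ has two edge-disjoint rainbow Hamilton cycles; (iv) if $n$ is odd and $3\leq k<n/3$, then $G_{n,k}^{C}$ has a rainbow cycle.
   Context: $G_{n,k}^{C}$ is the undirected graph whose vertices are the $k$-element subsets of $[n]=\{1,\dots,n\}$, with an edge between $A$ and $B$ whenever $A\setminus B=\{x\}$ and $B\setminus A=\{y\}$ for some $x\neq y$; this edge is labeled with the pair $\{x,y\}=A\triangle B$. A rainbow cycle (1-rainbow cycle) is a cycle (no repeated vertices) along which each of the $\binom{n}{2}$ pairs $\{x,y\}\subseteq[n]$ appears exactly once as an edge label. A rainbow Hamilton cycle is a rainbow cycle visiting every vertex. -}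

module Defs where

open import Data.Nat using (ℕ; _≤_; _<_; _*_; _/_; _%_)
open import Data.Fin using (Fin)
open import Data.Fin.Subset using (Subset; ⁅_⁆; _∪_; _─_; ∣_∣)
open import Data.Bool using (Bool) renaming (_≟_ to _≟ᵇ_)
open import Data.Vec.Properties using (≡-dec)
open import Data.List using (List; []; _∷_; zip; _++_; [_]; filter; length)
open import Data.List.Relation.Unary.All using (All)
open import Data.List.Relation.Unary.Unique.Propositional using (Unique)
open import Data.List.Membership.Propositional using (_∈_)
open import Data.Product using (_×_; ∃₂; proj₁; proj₂; _,_)
open import Data.Sum using (_⊎_)
open import Relation.Binary.PropositionalEquality using (_≡_; _≢_)
open import Relation.Nullary using (¬_; Dec)

IsVertex : (n k : ℕ) → Subset n → Set
IsVertex n k A = ∣ A ∣ ≡ k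

Adjacent : {n : ℕ} → Subset n → Subset n → Set
Adjacent {n} A B = ∃₂ λ (x y : Fin n) → x ≢ y × (A ─ B ≡ ⁅ x ⁆) × (B ─ A ≡ ⁅ y ⁆)

label : {n : ℕ} → Subset n × Subset n → Subset n
label (A , B) = (A ─ B) ∪ (B ─ A)

_≟ˢ_ : {n : ℕ} → (A B : Subset n) → Dec (A ≡ B)
_≟ˢ_ = ≡-dec _≟ᵇ_

cycEdges : {n : ℕ} → List (Subset n) → List (Subset n × Subset n)
cycEdges [] = []
cycEdges (v ∷ vs) = zip (v ∷ vs) (vs ++ [ v ])

record IsCycle (n k : ℕ) (C : List (Subset n)) : Set where
  field
    long     : 3 ≤ length C
    vertices : All (IsVertex n k) C
    distinct : Unique C
    adjacent : All (λ e → Adjacent (proj₁ e) (proj₂ e)) (cycEdges C)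

labelCount : {n : ℕ} → List (Subset n) → Fin n → Fin n → ℕ
labelCount C x y = length (filter (λ e → label e ≟ˢ (⁅ x ⁆ ∪ ⁅ y ⁆)) (cycEdges C))

IsRainbowCycle : (n k : ℕ) → List (Subset n) → Set
IsRainbowCycle n k C =
  IsCycle n k C × (∀ (x y : Fin n) → x ≢ y → labelCount C x y ≡ 1)

IsHamilton : (n k : ℕ) → List (Subset n) → Set
IsHamilton n k C = ∀ (A : Subset n) → IsVertex n k A → A ∈ C

IsRainbowHamiltonCycle : (n k : ℕ) → List (Subset n) → Set
IsRainbowHamiltonCycle n k C = IsRainbowCycle n k C × IsHamilton n k C

UsesEdge : {n : ℕ} → List (Subset n) → Subset n → Subset n → Set
UsesEdge C A B = (A , B) ∈ cycEdges C ⊎ (B , A) ∈ cycEdges C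

EdgeDisjoint : {n : ℕ} → List (Subset n) → List (Subset n) → Set
EdgeDisjoint {n} C D = ∀ (A B : Subset n) → UsesEdge C A B → ¬ UsesEdge D A B

{-# OPTIONS --safe #-}

-- For even n: along a cycle the membership of a fixed element is toggled an even
-- number of times, while n − 1 of the labels contain that element.
--
-- For n = 2ℓ + 1, identify [n] with ℤ/n. It suffices to find a block of ℓ sets, leading
-- from a set S to S + 1, whose ℓ label differences represent each class ±1, …, ±ℓ of
-- ℤ/n once and whose translation orbits are distinct: the n translates of the block
-- then close up to a rainbow cycle.
--
-- For k = 2 the block is {0, x₁}, …, {0, x_ℓ} with x_i = ± 2i, the signs alternating
-- except at one place i = j = ⌊ℓ/2⌋. The steps have differences ± (4i + 2) for i ≠ j and ± 2
-- for i = j; the last step {0, x_ℓ} → {x_ℓ, − x_ℓ} = {1, −1} has difference ± 1 = ± (4j + 2).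
-- Each class is also the difference of exactly one of these pairs, so the cycle is
-- Hamiltonian, and its image under x ↦ − x has no edge in common with it.
--
-- For k ≥ 3, put c = k − 1. The sets of the block are {0, …, c − 1} ∪ {w}. The walker w
-- zigzags with decreasing step sizes, first down from W, which keeps its positions
-- distinct; then it jumps by m to W + 1, and finally 0 moves to c. The step sizes
-- represent all classes except ± c and ± m. The zigzag ends at W minus their alternating sum,
-- which is about ℓ/2, and m is chosen near ℓ/2 with the parity of c so that the jump fits.

module Submission where

open import Defs
open import Algebra.Properties.CommutativeSemigroup using (interchange)
open import Data.Bool using (Bool; true; false; _xor_; not)
open import Data.Bool.Properties using (xor-assoc; xor-comm; xor-same; xor-identityʳ; not-involutive)
open import Data.Empty using (⊥; ⊥-elim)
open import Data.Fin using (Fin; toℕ; fromℕ<)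
open import Data.Fin.Properties using (toℕ-fromℕ<; toℕ-injective; toℕ<n; fromℕ<-cong) renaming (suc-injective to Fin-suc-injective)
open import Data.Fin.Subset using (Subset; ⁅_⁆; _∪_; _─_; ∣_∣; _∈_; _∉_; _⊆_) renaming (⊥ to ∅)
open import Data.Fin.Subset.Properties
open import Data.Integer using (ℤ; +_)
import Data.Integer as ℤ
import Data.Integer.DivMod as ℤ
open import Data.Integer.Divisibility.Signed using (_∣_; divides; ∣m∣n⇒∣m+n; ∣m⇒∣-m; ∣m∣n⇒∣m-n; ∣n⇒∣m*n; ∣⇒∣ᵤ)
import Data.Integer.Properties as ℤₚ
open import Data.Integer.Tactic.RingSolver using (solve-∀)
open import Data.List using (List; []; _∷_; [_]; _++_; zip; filter; foldr; length; map; applyUpTo)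
open import Data.List.Membership.Propositional using () renaming (_∈_ to _∈ᴸ_)
open import Data.List.Membership.Propositional.Properties using (∈-applyUpTo⁺; ∈-applyUpTo⁻; ∈-++⁺ˡ; ∈-++⁺ʳ)
open import Data.List.Properties using (length-map; length-applyUpTo; length-++; ++-assoc; map-applyUpTo; filter-none)
open import Data.List.Relation.Unary.All using (All; []; _∷_)
import Data.List.Relation.Unary.All as All
import Data.List.Relation.Unary.All.Properties as All
open import Data.List.Relation.Unary.AllPairs using (AllPairs; []; _∷_)
import Data.List.Relation.Unary.AllPairs as AllPairs
import Data.List.Relation.Unary.AllPairs.Properties as AllPairs
open import Data.List.Relation.Unary.Any using (Any; here; there)
import Data.List.Relation.Unary.Any as Any
import Data.List.Relation.Unary.Any.Properties as Any
open import Data.List.Relation.Unary.Unique.Propositional using (Unique)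
import Data.List.Relation.Unary.Unique.Propositional.Properties as Unique
open import Data.Nat using (ℕ; zero; suc; _≤_; _<_; _+_; _∸_; _*_; _/_; _%_; pred; ⌊_/2⌋; s≤s; z≤n; NonZero; ≢-nonZero; _≟_)
import Data.Nat.Divisibility as ℕ
open import Data.Nat.DivMod
open import Data.Nat.Properties
import Data.Nat.Tactic.RingSolver as ℕ
open import Data.Product using (_×_; ∃; ∃₂; _,_; proj₁; proj₂)
open import Data.Sum using (_⊎_; inj₁; inj₂; [_,_]′)
open import Data.Unit using (⊤; tt)
open import Data.Vec using ([]; _∷_; lookup)
import Data.Vec as Vec
open import Function using (_∘_; case_of_)
open import Relation.Binary.Definitions using (tri<; tri≈; tri>)
open import Relation.Binary.PropositionalEquality using (_≡_; _≢_; refl; sym; trans; cong; cong₂; subst; subst₂; isEquivalence; module ≡-Reasoning)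
open import Relation.Nullary using (¬_; Dec; yes; no; does)
open import Relation.Nullary.Decidable using (dec-true; dec-false; toSum; _⊎-dec_)
open import Relation.Unary using (Decidable)

-- Even n

xor-interchange : ∀ a b c d → (a xor b) xor (c xor d) ≡ (a xor c) xor (b xor d)
xor-interchange = interchange record
  { isCommutativeSemigroup = record
    { isSemigroup = record
      { isMagma = record { isEquivalence = isEquivalence ; ∙-cong = cong₂ _xor_ }
      ; assoc   = xor-assoc }
    ; comm = xor-comm } }

⨁ : ∀ n → (Fin n → Bool) → Bool
⨁ zero    f = false
⨁ (suc n) f = f Fin.zero xor ⨁ n (f ∘ Fin.suc)

⨁-cong : ∀ n {f g : Fin n → Bool} → (∀ j → f j ≡ g j) → ⨁ n f ≡ ⨁ n g
⨁-cong zero    f≗g = refl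
⨁-cong (suc n) f≗g = cong₂ _xor_ (f≗g Fin.zero) (⨁-cong n (f≗g ∘ Fin.suc))

⨁-false : ∀ n → ⨁ n (λ _ → false) ≡ false
⨁-false zero    = refl
⨁-false (suc n) = ⨁-false n

⨁-xor : ∀ n (f g : Fin n → Bool) → ⨁ n (λ j → f j xor g j) ≡ ⨁ n f xor ⨁ n g
⨁-xor zero    f g = refl
⨁-xor (suc n) f g =
  trans (cong ((f Fin.zero xor g Fin.zero) xor_) (⨁-xor n (f ∘ Fin.suc) (g ∘ Fin.suc)))
        (xor-interchange (f Fin.zero) (g Fin.zero) _ _)

⨁-single : ∀ n {f : Fin n → Bool} j → f j ≡ true → (∀ i → i ≢ j → f i ≡ false) → ⨁ n f ≡ true
⨁-single (suc n) Fin.zero    fj fi =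
  cong₂ _xor_ fj (trans (⨁-cong n (λ i → fi (Fin.suc i) λ ())) (⨁-false n))
⨁-single (suc n) (Fin.suc j) fj fi =
  cong₂ _xor_ (fi Fin.zero λ ()) (⨁-single n j fj (λ i i≢j → fi (Fin.suc i) (i≢j ∘ Fin-suc-injective)))

⨁-true⇒odd : ∀ n → ⨁ n (λ _ → true) ≡ true → n % 2 ≡ 1
⨁-true⇒odd (suc zero)    _ = refl
⨁-true⇒odd (suc (suc n)) p = ⨁-true⇒odd n (trans (sym (not-involutive (⨁ n _))) p)

⨁-true≡false⇒odd : ∀ n → ⨁ n (λ _ → true) ≡ false → suc n % 2 ≡ 1
⨁-true≡false⇒odd n p = ⨁-true⇒odd (suc n) (cong not p)

module _ {A : Set} where

  parity : (A → Bool) → List A → Bool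
  parity f = foldr (λ x b → f x xor b) false

  -- This turns the rainbow condition, a count equal to 1, into an equation in `Bool` that can be
  -- summed over labels.
  parity-filter : ∀ {P : A → Set} (P? : Decidable P) xs → length (filter P? xs) ≡ 1 →
                  parity (does ∘ P?) xs ≡ true
  parity-filter P? (x ∷ xs) eq with does (P? x)
  ... | false = parity-filter P? xs eq
  ... | true  = cong not (none xs (cong (λ { zero → 0 ; (suc m) → m }) eq))
    where
    none : ∀ xs → length (filter P? xs) ≡ 0 → parity (does ∘ P?) xs ≡ false
    none []       _  = refl
    none (x ∷ xs) eq with does (P? x)
    ... | false = none xs eq

  parity-⨁ : ∀ n (f : Fin n → A → Bool) xs →
             ⨁ n (λ j → parity (f j) xs) ≡ parity (λ x → ⨁ n (λ j → f j x)) xs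
  parity-⨁ n f []       = ⨁-false n
  parity-⨁ n f (x ∷ xs) =
    trans (⨁-xor n (λ j → f j x) (λ j → parity (f j) xs)) (cong (⨁ n (λ j → f j x) xor_) (parity-⨁ n f xs))

  parity-cong : ∀ {f g : A → Bool} {xs} → All (λ x → f x ≡ g x) xs → parity f xs ≡ parity g xs
  parity-cong []         = refl
  parity-cong (px ∷ pxs) = cong₂ _xor_ px (parity-cong pxs)

lookup-label : ∀ {n} (A B : Subset n) x → lookup (label (A , B)) x ≡ lookup A x xor lookup B x
lookup-label (a ∷ A) (b ∷ B) (Fin.suc x) = lookup-label A B x
lookup-label (true  ∷ A) (true  ∷ B) Fin.zero = refl
lookup-label (true  ∷ A) (false ∷ B) Fin.zero = refl
lookup-label (false ∷ A) (true  ∷ B) Fin.zero = refl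
lookup-label (false ∷ A) (false ∷ B) Fin.zero = refl

-- By `lookup-label` each edge contributes the change in membership of `x`, and the intermediate
-- vertices cancel. On a closed walk the two ends cancel as well.
parity-label-walk : ∀ {n} (x : Fin n) u w (vs : List (Subset n)) →
  parity (λ e → lookup (label e) x) (zip (u ∷ vs) (vs ++ [ w ])) ≡ lookup u x xor lookup w x
parity-label-walk x u w [] = trans (xor-identityʳ _) (lookup-label u w x)
parity-label-walk x u w (v ∷ vs) =
  trans (cong₂ _xor_ (lookup-label u v x) (parity-label-walk x v w vs))
        (telescope (lookup u x) (lookup v x) (lookup w x))
  where
  telescope : ∀ a b c → (a xor b) xor (b xor c) ≡ a xor c
  telescope a b c = trans (xor-assoc a b _)
    (cong (a xor_) (trans (sym (xor-assoc b b c)) (cong (_xor c) (xor-same b))))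

parity-label-cycle : ∀ {n} (x : Fin n) (C : List (Subset n)) →
  parity (λ e → lookup (label e) x) (cycEdges C) ≡ false
parity-label-cycle x []       = refl
parity-label-cycle x (v ∷ vs) = trans (parity-label-walk x v v vs) (xor-same (lookup v x))

∈-pair⁻ : ∀ {n} {x u v : Fin n} → x ∈ ⁅ u ⁆ ∪ ⁅ v ⁆ → x ≡ u ⊎ x ≡ v
∈-pair⁻ {u = u} {v} x∈ with x∈p∪q⁻ ⁅ u ⁆ ⁅ v ⁆ x∈
... | inj₁ x∈u = inj₁ (x∈⁅y⁆⇒x≡y u x∈u)
... | inj₂ x∈v = inj₂ (x∈⁅y⁆⇒x≡y v x∈v)

∈-pairˡ : ∀ {n} (u v : Fin n) → u ∈ ⁅ u ⁆ ∪ ⁅ v ⁆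
∈-pairˡ u v = x∈p∪q⁺ (inj₁ (x∈⁅x⁆ u))

∈-pairʳ : ∀ {n} (u v : Fin n) → v ∈ ⁅ u ⁆ ∪ ⁅ v ⁆
∈-pairʳ u v = x∈p∪q⁺ {p = ⁅ u ⁆} (inj₂ (x∈⁅x⁆ v))

pair-injective : ∀ {n} {x y u v : Fin n} → x ≢ y → ⁅ x ⁆ ∪ ⁅ y ⁆ ≡ ⁅ u ⁆ ∪ ⁅ v ⁆ →
  (x ≡ u × y ≡ v) ⊎ (x ≡ v × y ≡ u)
pair-injective {x = x} {y} x≢y eq
  with ∈-pair⁻ (subst (x ∈_) eq (∈-pairˡ x y)) | ∈-pair⁻ (subst (y ∈_) eq (∈-pairʳ x y))
... | inj₁ x≡u | inj₁ y≡u = ⊥-elim (x≢y (trans x≡u (sym y≡u)))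
... | inj₁ x≡u | inj₂ y≡v = inj₁ (x≡u , y≡v)
... | inj₂ x≡v | inj₁ y≡u = inj₂ (x≡v , y≡u)
... | inj₂ x≡v | inj₂ y≡v = ⊥-elim (x≢y (trans x≡v (sym y≡v)))

-- If one of `a`, `b` is `zero`, exactly one `j` matches, namely the predecessor of the other;
-- otherwise no pair through `zero` matches.
⨁-pair : ∀ {n} (a b : Fin (suc n)) → a ≢ b →
  ⨁ n (λ j → does ((⁅ a ⁆ ∪ ⁅ b ⁆) ≟ˢ (⁅ Fin.zero ⁆ ∪ ⁅ Fin.suc j ⁆))) ≡ lookup (⁅ a ⁆ ∪ ⁅ b ⁆) Fin.zero
⨁-pair Fin.zero Fin.zero a≢b = ⊥-elim (a≢b refl)
⨁-pair {n} Fin.zero (Fin.suc b) a≢b = ⨁-single n b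
  (dec-true ((⁅ Fin.zero ⁆ ∪ ⁅ Fin.suc b ⁆) ≟ˢ (⁅ Fin.zero ⁆ ∪ ⁅ Fin.suc b ⁆)) refl)
  (λ i i≢b → dec-false ((⁅ Fin.zero ⁆ ∪ ⁅ Fin.suc b ⁆) ≟ˢ (⁅ Fin.zero ⁆ ∪ ⁅ Fin.suc i ⁆)) λ eq →
    case pair-injective {u = Fin.zero} {Fin.suc i} a≢b eq of λ { (inj₁ (_ , b≡i)) → i≢b (Fin-suc-injective (sym b≡i)) })
⨁-pair {n} (Fin.suc a) Fin.zero a≢b = ⨁-single n a
  (dec-true ((⁅ Fin.suc a ⁆ ∪ ⁅ Fin.zero ⁆) ≟ˢ (⁅ Fin.zero ⁆ ∪ ⁅ Fin.suc a ⁆)) (∪-comm ⁅ Fin.suc a ⁆ ⁅ Fin.zero ⁆))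
  (λ i i≢a → dec-false ((⁅ Fin.suc a ⁆ ∪ ⁅ Fin.zero ⁆) ≟ˢ (⁅ Fin.zero ⁆ ∪ ⁅ Fin.suc i ⁆)) λ eq →
    case pair-injective {u = Fin.zero} {Fin.suc i} a≢b eq of λ { (inj₂ (a≡i , _)) → i≢a (Fin-suc-injective (sym a≡i)) })
⨁-pair {n} (Fin.suc a) (Fin.suc b) a≢b = trans
  (⨁-cong n λ j → dec-false ((⁅ Fin.suc a ⁆ ∪ ⁅ Fin.suc b ⁆) ≟ˢ (⁅ Fin.zero ⁆ ∪ ⁅ Fin.suc j ⁆)) λ ())
  (⨁-false n)

label-adjacent : ∀ {n} {A B : Subset n} ((x , y , _) : Adjacent A B) → label (A , B) ≡ ⁅ x ⁆ ∪ ⁅ y ⁆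
label-adjacent (x , y , x≢y , A─B , B─A) = cong₂ _∪_ A─B B─A

-- The edges whose label contains `zero` are counted modulo 2 in two ways. Grouped by label there is
-- one for each of the `n` pairs through `zero`; taken along the cycle they telescope to `false`.
-- Hence `n` is even.
rainbow-cycle⇒odd : ∀ n k (C : List (Subset (suc n))) → IsRainbowCycle (suc n) k C → suc n % 2 ≡ 1
rainbow-cycle⇒odd n k C (isCycle , rainbow) = ⨁-true≡false⇒odd n (begin
  ⨁ n (λ _ → true)
    ≡⟨ ⨁-cong n (λ j → parity-filter (edge? j) E (rainbow Fin.zero (Fin.suc j) λ ())) ⟨
  ⨁ n (λ j → parity (does ∘ edge? j) E)
    ≡⟨ parity-⨁ n (λ j → does ∘ edge? j) E ⟩
  parity (λ e → ⨁ n (λ j → does (edge? j e))) E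
    ≡⟨ parity-cong (All.map (λ {e} → per-edge e) (IsCycle.adjacent isCycle)) ⟩
  parity (λ e → lookup (label e) Fin.zero) E
    ≡⟨ parity-label-cycle Fin.zero C ⟩
  false ∎)
  where
  open ≡-Reasoning
  E = cycEdges C
  edge? : ∀ j → Decidable (λ e → label e ≡ ⁅ Fin.zero ⁆ ∪ ⁅ Fin.suc j ⁆)
  edge? j e = label e ≟ˢ (⁅ Fin.zero ⁆ ∪ ⁅ Fin.suc j ⁆)
  per-edge : ∀ e → Adjacent (proj₁ e) (proj₂ e) → ⨁ n (λ j → does (edge? j e)) ≡ lookup (label e) Fin.zero
  per-edge e adj@(x , y , x≢y , _) rewrite label-adjacent adj = ⨁-pair x y x≢y

-- Cycles listed by an index, and exchanges of one element

module _ {n : ℕ} where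

  zip-applyUpTo : ∀ (V : ℕ → Subset n) m →
    zip (applyUpTo V (suc m)) (applyUpTo (V ∘ suc) m ++ [ V (suc m) ])
      ≡ applyUpTo (λ t → V t , V (suc t)) (suc m)
  zip-applyUpTo V zero    = refl
  zip-applyUpTo V (suc m) = cong (_ ∷_) (zip-applyUpTo (V ∘ suc) m)

  -- Since `V` returns to its start at `m`, the closing edge has the same form as all the others and
  -- needs no separate treatment.
  cycEdges-applyUpTo : ∀ (V : ℕ → Subset n) m → V m ≡ V 0 →
    cycEdges (applyUpTo V m) ≡ applyUpTo (λ t → V t , V (suc t)) m
  cycEdges-applyUpTo V zero    _     = refl
  cycEdges-applyUpTo V (suc m) Vm≡V0 =
    trans (cong (λ v → zip (applyUpTo V (suc m)) (applyUpTo (V ∘ suc) m ++ [ v ])) (sym Vm≡V0))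
          (zip-applyUpTo V m)

-- Splits the rainbow count into two facts about a label: some index carries it, and no other index
-- does.
length-filter-applyUpTo : ∀ {A : Set} {P : A → Set} (P? : Decidable P) (f : ℕ → A) m {t} →
  t < m → P (f t) → (∀ {s} → s < m → P (f s) → s ≡ t) → length (filter P? (applyUpTo f m)) ≡ 1
length-filter-applyUpTo P? f (suc m) {zero} _ Pft unique with P? (f 0)
... | no ¬P = ⊥-elim (¬P Pft)
... | yes _ = cong (suc ∘ length) (filter-none P? (All.applyUpTo⁺₁ (f ∘ suc) m
                λ s<m Pfs → case unique (s≤s s<m) Pfs of λ ()))
length-filter-applyUpTo P? f (suc m) {suc t} (s≤s t<m) Pft unique with P? (f 0)
... | yes P0 = case unique (s≤s z≤n) P0 of λ ()
... | no _   = length-filter-applyUpTo P? (f ∘ suc) m t<m Pft λ s<m Pfs → suc-injective (unique (s≤s s<m) Pfs)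

∣⁅x⁆∪p∣ : ∀ {n} {x : Fin n} {p} → x ∉ p → ∣ ⁅ x ⁆ ∪ p ∣ ≡ suc ∣ p ∣
∣⁅x⁆∪p∣ {x = Fin.zero}  {true  ∷ p} x∉p = ⊥-elim (x∉p Vec.here)
∣⁅x⁆∪p∣ {x = Fin.zero}  {false ∷ p} x∉p = cong (suc ∘ ∣_∣) (∪-identityˡ p)
∣⁅x⁆∪p∣ {x = Fin.suc x} {true  ∷ p} x∉p = cong suc (∣⁅x⁆∪p∣ (x∉p ∘ Vec.there))
∣⁅x⁆∪p∣ {x = Fin.suc x} {false ∷ p} x∉p = ∣⁅x⁆∪p∣ (x∉p ∘ Vec.there)

x∈p─q⁻ : ∀ {n} {x : Fin n} p q → x ∈ p ─ q → x ∈ p × x ∉ q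
x∈p─q⁻ {x = Fin.zero} (true  ∷ p) (false ∷ q) Vec.here = Vec.here , λ ()
x∈p─q⁻ {x = Fin.zero} (true  ∷ p) (true  ∷ q) ()
x∈p─q⁻ {x = Fin.zero} (false ∷ p) (false ∷ q) ()
x∈p─q⁻ {x = Fin.zero} (false ∷ p) (true  ∷ q) ()
x∈p─q⁻ (_ ∷ p) (_ ∷ q) (Vec.there x∈) with x∈p─q⁻ p q x∈
... | x∈p , x∉q = Vec.there x∈p , λ { (Vec.there x∈q) → x∉q x∈q }

∪-─-exchange : ∀ {n} {x y : Fin n} {p} → x ≢ y → x ∉ p → (⁅ x ⁆ ∪ p) ─ (⁅ y ⁆ ∪ p) ≡ ⁅ x ⁆
∪-─-exchange {x = x} {y} {p} x≢y x∉p = ⊆-antisym forth back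
  where
  forth : (⁅ x ⁆ ∪ p) ─ (⁅ y ⁆ ∪ p) ⊆ ⁅ x ⁆
  forth z∈ with x∈p─q⁻ (⁅ x ⁆ ∪ p) (⁅ y ⁆ ∪ p) z∈
  ... | z∈xp , z∉yp with x∈p∪q⁻ ⁅ x ⁆ p z∈xp
  ...   | inj₁ z∈x = z∈x
  ...   | inj₂ z∈p = ⊥-elim (z∉yp (x∈p∪q⁺ (inj₂ z∈p)))
  back : ⁅ x ⁆ ⊆ (⁅ x ⁆ ∪ p) ─ (⁅ y ⁆ ∪ p)
  back z∈x with refl ← x∈⁅y⁆⇒x≡y x z∈x = x∈p∧x∉q⇒x∈p─q (x∈p∪q⁺ (inj₁ z∈x))
    λ x∈yp → [ (λ x∈y → x≢y (x∈⁅y⁆⇒x≡y y x∈y)) , x∉p ]′ (x∈p∪q⁻ ⁅ y ⁆ p x∈yp)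

Adjacent-exchange : ∀ {n} {x y : Fin n} {p} → x ≢ y → x ∉ p → y ∉ p → Adjacent (⁅ x ⁆ ∪ p) (⁅ y ⁆ ∪ p)
Adjacent-exchange x≢y x∉p y∉p =
  _ , _ , x≢y , ∪-─-exchange x≢y x∉p , ∪-─-exchange (x≢y ∘ sym) y∉p

-- Blocks and their translates

module Modular (ℓ : ℕ) where

  n : ℕ
  n = suc (ℓ + ℓ)

  infix 4 _≋_ _≄_ _∼_

  -- A record, so that `a` and `b` can be recovered from the type of a proof; their difference alone
  -- does not determine them.
  record _≋_ (a b : ℤ) : Set where
    constructor mod
    field div : + n ∣ (a ℤ.- b)
  open _≋_ public

  _≄_ : ℤ → ℤ → Set
  a ≄ b = ¬ a ≋ b

  -- Only the difference of the two sides matters, so every rearrangement of a congruence becomes a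
  -- ring identity for `solve-∀`.
  ≋-linear : ∀ {a b c d} → c ℤ.- d ≡ a ℤ.- b → a ≋ b → c ≋ d
  ≋-linear eq (mod a≋b) = mod (subst (+ n ∣_) (sym eq) a≋b)

  ≋-refl : ∀ {a} → a ≋ a
  ≋-refl {a} = mod (divides (+ 0) (ℤₚ.+-inverseʳ a))

  ≋-reflexive : ∀ {a b} → a ≡ b → a ≋ b
  ≋-reflexive refl = ≋-refl

  ≋-sym : ∀ {a b} → a ≋ b → b ≋ a
  ≋-sym {a} {b} (mod p) = mod (subst (+ n ∣_) (eq a b) (∣m⇒∣-m p))
    where
    eq : ∀ a b → ℤ.- (a ℤ.- b) ≡ b ℤ.- a
    eq = solve-∀

  infixr 5 _∙_
  _∙_ : ∀ {a b c} → a ≋ b → b ≋ c → a ≋ c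
  _∙_ {a} {b} {c} (mod p) (mod q) = mod (subst (+ n ∣_) (eq a b c) (∣m∣n⇒∣m+n p q))
    where
    eq : ∀ a b c → (a ℤ.- b) ℤ.+ (b ℤ.- c) ≡ a ℤ.- c
    eq = solve-∀

  ≋-+ : ∀ {a b c d} → a ≋ b → c ≋ d → a ℤ.+ c ≋ b ℤ.+ d
  ≋-+ {a} {b} {c} {d} (mod p) (mod q) = mod (subst (+ n ∣_) (eq a b c d) (∣m∣n⇒∣m+n p q))
    where
    eq : ∀ a b c d → (a ℤ.- b) ℤ.+ (c ℤ.- d) ≡ (a ℤ.+ c) ℤ.- (b ℤ.+ d)
    eq = solve-∀

  ≋-neg : ∀ {a b} → a ≋ b → ℤ.- a ≋ ℤ.- b
  ≋-neg {a} {b} (mod p) = mod (subst (+ n ∣_) (eq a b) (∣m⇒∣-m p))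
    where
    eq : ∀ a b → ℤ.- (a ℤ.- b) ≡ ℤ.- a ℤ.- ℤ.- b
    eq = solve-∀

  ≋-- : ∀ {a b c d} → a ≋ b → c ≋ d → a ℤ.- c ≋ b ℤ.- d
  ≋-- p q = ≋-+ p (≋-neg q)

  -- 2 is invertible: (2ℓ + 1) (a − b) − ℓ (2a − 2b) = a − b.
  ≋-halve : ∀ {a b} → a ℤ.+ a ≋ b ℤ.+ b → a ≋ b
  ≋-halve {a} {b} (mod p) = mod (subst (+ n ∣_) (eq (+ ℓ) a b)
      (∣m∣n⇒∣m-n (divides (a ℤ.- b) refl) (∣n⇒∣m*n (+ ℓ) p)))
    where
    eq : ∀ l a b → (a ℤ.- b) ℤ.* (+ 1 ℤ.+ (l ℤ.+ l)) ℤ.- l ℤ.* (a ℤ.+ a ℤ.- (b ℤ.+ b)) ≡ a ℤ.- b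
    eq = solve-∀

  n≋0 : + n ≋ + 0
  n≋0 = mod (divides (+ 1) (trans (ℤₚ.+-identityʳ (+ n)) (sym (ℤₚ.*-identityˡ (+ n)))))

  ≋-complement : ∀ a b → a + b ≡ n → + a ≋ ℤ.- + b
  ≋-complement a b eq = ≋-linear (e (+ a) (+ b)) (subst (λ m → + m ≋ + 0) (sym eq) n≋0)
    where
    e : ∀ a b → a ℤ.- ℤ.- b ≡ a ℤ.+ b ℤ.- + 0
    e = solve-∀

  residue : ℤ → ℕ
  residue a = a ℤ.%ℕ n

  residue<n : ∀ a → residue a < n
  residue<n a = ℤ.n%ℕd<d a n

  residue-≋ : ∀ a → + residue a ≋ a
  residue-≋ a = ≋-sym (mod (divides (a ℤ./ℕ n)
    (trans (cong (ℤ._- + residue a) (ℤ.a≡a%ℕn+[a/ℕn]*n a n)) (eq (+ residue a) ((a ℤ./ℕ n) ℤ.* + n)))))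
    where
    eq : ∀ r s → (r ℤ.+ s) ℤ.- r ≡ s
    eq = solve-∀

  ≋⇒≡ : ∀ {a b} → a < n → b < n → + a ≋ + b → a ≡ b
  ≋⇒≡ {a} {b} a<n b<n (mod p) = ℤₚ.+-injective (ℤₚ.i-j≡0⇒i≡j (+ a) (+ b) (ℤₚ.∣i∣≡0⇒i≡0 (small ∣a-b∣<n (∣⇒∣ᵤ p))))
    where
    small : ∀ {m} → m < n → n ℕ.∣ m → m ≡ 0
    small {zero}  _   _   = refl
    small {suc m} m<n n∣m = ⊥-elim (≤⇒≯ (ℕ.∣⇒≤ n∣m) m<n)
    ∣a-b∣<n : ℤ.∣ + a ℤ.- + b ∣ < n
    ∣a-b∣<n = subst (λ z → ℤ.∣ z ∣ < n) (sym (ℤₚ.m-n≡m⊖n a b))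
      (≤-<-trans (ℤₚ.∣m⊝n∣≤m⊔n a b) (⊔-lub a<n b<n))

  -- An unordered pair fixes its difference only up to sign. The nonzero residues form `ℓ` classes
  -- under this relation, as many as a block has steps.
  _∼_ : ℤ → ℤ → Set
  a ∼ b = a ≋ b ⊎ a ≋ ℤ.- b

  ≋-neg-flip : ∀ {a b} → a ≋ ℤ.- b → b ≋ ℤ.- a
  ≋-neg-flip {a} {b} p = ≋-reflexive (sym (ℤₚ.neg-involutive b)) ∙ ≋-neg (≋-sym p)

  ∼-sym : ∀ {a b} → a ∼ b → b ∼ a
  ∼-sym (inj₁ p) = inj₁ (≋-sym p)
  ∼-sym (inj₂ p) = inj₂ (≋-neg-flip p)

  ∼-trans : ∀ {a b c} → a ∼ b → b ∼ c → a ∼ c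
  ∼-trans (inj₁ p) (inj₁ q) = inj₁ (p ∙ q)
  ∼-trans (inj₁ p) (inj₂ q) = inj₂ (p ∙ q)
  ∼-trans (inj₂ p) (inj₁ q) = inj₂ (p ∙ ≋-neg q)
  ∼-trans (inj₂ p) (inj₂ q) = inj₁ (p ∙ ≋-sym (≋-neg-flip q))

  infix 4 _∈̃_ _⊑_ _≐_

  _∈̃_ : ℤ → List ℤ → Set
  a ∈̃ L = Any (a ≋_) L

  _⊑_ : List ℤ → List ℤ → Set
  L ⊑ M = ∀ {a} → a ∈̃ L → a ∈̃ M

  -- Lists stand for sets of residues: order, repetition and the choice of representatives are
  -- ignored.
  _≐_ : List ℤ → List ℤ → Set
  L ≐ M = L ⊑ M × M ⊑ L

  shift : ℤ → List ℤ → List ℤ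
  shift r = map (λ a → r ℤ.+ a)

  ∈̃-resp : ∀ {a b} L → a ≋ b → b ∈̃ L → a ∈̃ L
  ∈̃-resp L a≋b = Any.map (a≋b ∙_)

  ∈̃-shift⁺ : ∀ {a} r {L} → a ℤ.- r ∈̃ L → a ∈̃ shift r L
  ∈̃-shift⁺ {a} r = Any.map⁺ ∘ Any.map (λ {b} → ≋-linear (eq a b r))
    where
    eq : ∀ a b r → a ℤ.- (r ℤ.+ b) ≡ (a ℤ.- r) ℤ.- b
    eq = solve-∀

  ∈̃-shift⁻ : ∀ {a} r {L} → a ∈̃ shift r L → a ℤ.- r ∈̃ L
  ∈̃-shift⁻ {a} r = Any.map (λ {b} → ≋-linear (eq a b r)) ∘ Any.map⁻
    where
    eq : ∀ a b r → (a ℤ.- r) ℤ.- b ≡ a ℤ.- (r ℤ.+ b)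
    eq = solve-∀

  ≐-sym : ∀ {L M} → L ≐ M → M ≐ L
  ≐-sym (p , q) = q , p

  ≐-trans : ∀ {L M K} → L ≐ M → M ≐ K → L ≐ K
  ≐-trans (p , q) (p′ , q′) = (p′ ∘ p) , (q ∘ q′)

  ≐-shift : ∀ r {L M} → L ≐ M → shift r L ≐ shift r M
  ≐-shift r (p , q) = (∈̃-shift⁺ r ∘ p ∘ ∈̃-shift⁻ r) , (∈̃-shift⁺ r ∘ q ∘ ∈̃-shift⁻ r)

  shift-resp : ∀ {r s} L → r ≋ s → shift r L ⊑ shift s L
  shift-resp {r} {s} L r≋s {a} = ∈̃-shift⁺ s ∘ ∈̃-resp L (≋-- (≋-refl {a}) (≋-sym r≋s)) ∘ ∈̃-shift⁻ r

  ≐-shift-resp : ∀ {r s} L → r ≋ s → shift r L ≐ shift s L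
  ≐-shift-resp L r≋s = shift-resp L r≋s , shift-resp L (≋-sym r≋s)

  ≐-shift-shift : ∀ r s {t} L → r ℤ.+ s ≋ t → shift r (shift s L) ≐ shift t L
  ≐-shift-shift r s {t} L eq =
      (λ {a} → ∈̃-shift⁺ t ∘ ∈̃-resp L (≋-- (≋-refl {a}) (≋-sym eq) ∙ ≋-reflexive (e a r s)) ∘ ∈̃-shift⁻ s ∘ ∈̃-shift⁻ r)
    , (λ {a} → ∈̃-shift⁺ r ∘ ∈̃-shift⁺ s ∘ ∈̃-resp L (≋-reflexive (sym (e a r s)) ∙ ≋-- (≋-refl {a}) eq) ∘ ∈̃-shift⁻ t)
    where
    e : ∀ a r s → a ℤ.- (r ℤ.+ s) ≡ a ℤ.- r ℤ.- s
    e = solve-∀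

  Apart : List ℤ → Set
  Apart = AllPairs _≄_

  shift-apart : ∀ r {L} → Apart L → Apart (shift r L)
  shift-apart r = AllPairs.map⁺ ∘ AllPairs.map (λ {a} {b} a≄b → a≄b ∘ ≋-linear (eq a b r))
    where
    eq : ∀ a b r → a ℤ.- b ≡ (r ℤ.+ a) ℤ.- (r ℤ.+ b)
    eq = solve-∀

  -- An identification of the residues modulo `n` with `Fin n`. It is kept abstract so that a single
  -- block, read through `standard` and through `mirror`, yields two cycles.
  record Coordinate : Set where
    field
      φ            : ℤ → Fin n
      φ-injective  : ∀ {a b} → φ a ≡ φ b → a ≋ b
      φ-cong       : ∀ {a b} → a ≋ b → φ a ≡ φ b
      φ-surjective : ∀ x → ∃ λ a → φ a ≡ x

  standard : Coordinate
  standard = record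
    { φ            = λ a → fromℕ< (residue<n a)
    ; φ-injective  = λ {a} {b} eq → ≋-sym (residue-≋ a) ∙ ≋-reflexive (cong +_
        (trans (sym (toℕ-fromℕ< (residue<n a))) (trans (cong toℕ eq) (toℕ-fromℕ< (residue<n b))))) ∙ residue-≋ b
    ; φ-cong       = λ {a} {b} a≋b → fromℕ<-cong _ _
        (≋⇒≡ (residue<n a) (residue<n b) (residue-≋ a ∙ a≋b ∙ ≋-sym (residue-≋ b))) _ _
    ; φ-surjective = λ x → + toℕ x , toℕ-injective (trans (toℕ-fromℕ< (residue<n (+ toℕ x)))
        (≋⇒≡ (residue<n (+ toℕ x)) (toℕ<n x) (residue-≋ (+ toℕ x))))
    }

  mirror : Coordinate → Coordinate
  mirror κ = record
    { φ            = φ ∘ ℤ.-_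
    ; φ-injective  = λ {a} {b} eq → ≋-reflexive (sym (ℤₚ.neg-involutive a)) ∙ ≋-neg (φ-injective eq)
        ∙ ≋-reflexive (ℤₚ.neg-involutive b)
    ; φ-cong       = φ-cong ∘ ≋-neg
    ; φ-surjective = λ x → let a , φa≡x = φ-surjective x in
        ℤ.- a , trans (cong φ (ℤₚ.neg-involutive a)) φa≡x
    }
    where open Coordinate κ

  module Realisation (κ : Coordinate) where
    open Coordinate κ public

    ⟦_⟧ : List ℤ → Subset n
    ⟦ [] ⟧    = ∅
    ⟦ a ∷ L ⟧ = ⁅ φ a ⁆ ∪ ⟦ L ⟧

    ∈⟦⟧⁺ : ∀ {a L} → a ∈̃ L → φ a ∈ ⟦ L ⟧
    ∈⟦⟧⁺ {L = b ∷ L} (here a≋b)  = x∈p∪q⁺ (inj₁ (subst (_∈ ⁅ φ b ⁆) (sym (φ-cong a≋b)) (x∈⁅x⁆ (φ b))))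
    ∈⟦⟧⁺ {L = b ∷ L} (there a∈L) = x∈p∪q⁺ {p = ⁅ φ b ⁆} (inj₂ (∈⟦⟧⁺ a∈L))

    ∈⟦⟧⁻ : ∀ {a} L → φ a ∈ ⟦ L ⟧ → a ∈̃ L
    ∈⟦⟧⁻ []      a∈ = ⊥-elim (∉⊥ a∈)
    ∈⟦⟧⁻ (b ∷ L) a∈ with x∈p∪q⁻ ⁅ φ b ⁆ ⟦ L ⟧ a∈
    ... | inj₁ a∈b = here (φ-injective (x∈⁅y⁆⇒x≡y (φ b) a∈b))
    ... | inj₂ a∈L = there (∈⟦⟧⁻ L a∈L)

    ⟦⟧-mono : ∀ {L M} → L ⊑ M → ⟦ L ⟧ ⊆ ⟦ M ⟧
    ⟦⟧-mono {L} L⊑M {x} x∈ with φ-surjective x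
    ... | a , refl = ∈⟦⟧⁺ (L⊑M (∈⟦⟧⁻ L x∈))

    ⟦⟧-cong : ∀ {L M} → L ≐ M → ⟦ L ⟧ ≡ ⟦ M ⟧
    ⟦⟧-cong (L⊑M , M⊑L) = ⊆-antisym (⟦⟧-mono L⊑M) (⟦⟧-mono M⊑L)

    ⟦⟧-injective : ∀ L M → ⟦ L ⟧ ≡ ⟦ M ⟧ → L ≐ M
    ⟦⟧-injective L M eq = (λ a∈L → ∈⟦⟧⁻ M (subst (_ ∈_) eq (∈⟦⟧⁺ a∈L)))
                        , (λ a∈M → ∈⟦⟧⁻ L (subst (_ ∈_) (sym eq) (∈⟦⟧⁺ a∈M)))

    ∉⟦⟧ : ∀ {a L} → All (a ≄_) L → φ a ∉ ⟦ L ⟧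
    ∉⟦⟧ {L = L} a≄L a∈L = All.All¬⇒¬Any a≄L (∈⟦⟧⁻ L a∈L)

    ∣⟦⟧∣ : ∀ {L} → Apart L → ∣ ⟦ L ⟧ ∣ ≡ length L
    ∣⟦⟧∣ []             = ∣⊥∣≡0 n
    ∣⟦⟧∣ (a≄L ∷ apartL) = trans (∣⁅x⁆∪p∣ (∉⟦⟧ a≄L)) (cong suc (∣⟦⟧∣ apartL))

    Adjacent-⟦⟧ : ∀ {a b L} → Apart (b ∷ a ∷ L) → Adjacent ⟦ a ∷ L ⟧ ⟦ b ∷ L ⟧
    Adjacent-⟦⟧ ((b≄a ∷ b≄L) ∷ a≄L ∷ _) =
      Adjacent-exchange (b≄a ∘ ≋-sym ∘ φ-injective) (∉⟦⟧ a≄L) (∉⟦⟧ b≄L)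

    label-⟦⟧ : ∀ {a b L} → Apart (b ∷ a ∷ L) → label (⟦ a ∷ L ⟧ , ⟦ b ∷ L ⟧) ≡ ⁅ φ a ⁆ ∪ ⁅ φ b ⁆
    label-⟦⟧ ap@((_ ∷ _) ∷ _ ∷ _) = label-adjacent (Adjacent-⟦⟧ ap)

    -- Two symmetric invariants of a pair. When labels are compared, the difference up to sign
    -- identifies the step of the block and the sum identifies the translate.
    pair-difference-sum : ∀ {a b c d} → a ≄ b → ⁅ φ a ⁆ ∪ ⁅ φ b ⁆ ≡ ⁅ φ c ⁆ ∪ ⁅ φ d ⁆ →
      (b ℤ.- a ∼ d ℤ.- c) × (a ℤ.+ b ≋ c ℤ.+ d)
    pair-difference-sum {a} {b} {c} {d} a≄b eq with pair-injective (a≄b ∘ φ-injective) eq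
    ... | inj₁ (a≡c , b≡d) = let a≋c = φ-injective a≡c ; b≋d = φ-injective b≡d in
      inj₁ (≋-- b≋d a≋c) , ≋-+ a≋c b≋d
    ... | inj₂ (a≡d , b≡c) = let a≋d = φ-injective a≡d ; b≋c = φ-injective b≡c in
      inj₂ (≋-- b≋c a≋d ∙ ≋-reflexive (neg-- c d)) , (≋-+ a≋d b≋c ∙ ≋-reflexive (ℤₚ.+-comm d c))
      where
      neg-- : ∀ c d → c ℤ.- d ≡ ℤ.- (d ℤ.- c)
      neg-- = solve-∀

  -- Step `i` replaces `from i` by `to i` and keeps `rest i`. By `wrap` the next translate starts
  -- where this one ends, by `orbit` all translates of the `ℓ` states are distinct, and the two step
  -- conditions put each nonzero class on exactly one step.
  record Block (k : ℕ) : Set where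
    field
      state rest : ℕ → List ℤ
      from to    : ℕ → ℤ
      before : ∀ {i} → i < ℓ → state i ≐ from i ∷ rest i
      after  : ∀ {i} → i < ℓ → state (suc i) ≐ to i ∷ rest i
      wrap   : state ℓ ≐ shift (+ 1) (state 0)
      size   : ∀ {i} → i < ℓ → suc (length (rest i)) ≡ k
      apart  : ∀ {i} → i < ℓ → Apart (to i ∷ from i ∷ rest i)
      orbit  : ∀ {i j} → i < ℓ → j < ℓ → ∀ r → state i ≐ shift r (state j) → i ≡ j × r ≋ + 0
      step-injective  : ∀ {i j} → i < ℓ → j < ℓ → to i ℤ.- from i ∼ to j ℤ.- from j → i ≡ j
      step-surjective : ∀ d → d ≄ + 0 → ∃ λ i → i < ℓ × d ∼ to i ℤ.- from i

  module Cycle .{{_ : NonZero ℓ}} (1<ℓ : 1 < ℓ) {k : ℕ} (block : Block k) (κ : Coordinate) where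
    open Block block
    open Realisation κ

    -- The translates of the block are laid end to end: the quotient counts translates, the
    -- remainder is the place within one.
    vertex : ℕ → Subset n
    vertex t = ⟦ shift (+ (t / ℓ)) (state (t % ℓ)) ⟧

    cycle : List (Subset n)
    cycle = applyUpTo vertex (n * ℓ)

    edge : ℕ → Subset n × Subset n
    edge t = vertex t , vertex (suc t)

    [i+qℓ]%ℓ : ∀ {i} q → i < ℓ → (i + q * ℓ) % ℓ ≡ i
    [i+qℓ]%ℓ {i} q i<ℓ = trans ([m+kn]%n≡m%n i q ℓ) (m<n⇒m%n≡m i<ℓ)

    [i+qℓ]/ℓ : ∀ {i} q → i < ℓ → (i + q * ℓ) / ℓ ≡ q
    [i+qℓ]/ℓ {i} q i<ℓ = trans (+-distrib-/-∣ʳ i (ℕ.divides-refl q))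
      (cong₂ _+_ (m<n⇒m/n≡0 i<ℓ) (m*n/n≡m q ℓ))

    vertex-at : ∀ {i} q → i < ℓ → vertex (i + q * ℓ) ≡ ⟦ shift (+ q) (state i) ⟧
    vertex-at q i<ℓ = cong₂ (λ p j → ⟦ shift (+ p) (state j) ⟧) ([i+qℓ]/ℓ q i<ℓ) ([i+qℓ]%ℓ q i<ℓ)

    vertex-before : ∀ t → vertex t ≡ ⟦ shift (+ (t / ℓ)) (from (t % ℓ) ∷ rest (t % ℓ)) ⟧
    vertex-before t = ⟦⟧-cong (≐-shift (+ (t / ℓ)) (before (m%n<n t ℓ)))

    vertex-after : ∀ t → vertex (suc t) ≡ ⟦ shift (+ (t / ℓ)) (to (t % ℓ) ∷ rest (t % ℓ)) ⟧
    vertex-after t = begin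
      vertex (suc t)                           ≡⟨ cong (vertex ∘ suc) (m≡m%n+[m/n]*n t ℓ) ⟩
      vertex (suc (t % ℓ) + t / ℓ * ℓ)         ≡⟨ advance (t / ℓ) (m%n<n t ℓ) ⟩
      ⟦ shift (+ (t / ℓ)) (state (suc (t % ℓ))) ⟧ ≡⟨ ⟦⟧-cong (≐-shift (+ (t / ℓ)) (after (m%n<n t ℓ))) ⟩
      ⟦ shift (+ (t / ℓ)) (to (t % ℓ) ∷ rest (t % ℓ)) ⟧ ∎
      where
      open ≡-Reasoning
      q+1≋1+q : ∀ {q} → + q ℤ.+ + 1 ≋ + suc q
      q+1≋1+q {q} = ≋-reflexive (cong +_ (+-comm q 1))
      advance : ∀ {i} q → i < ℓ → vertex (suc i + q * ℓ) ≡ ⟦ shift (+ q) (state (suc i)) ⟧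
      advance {i} q i<ℓ with suc i ≟ ℓ
      ... | no  1+i≢ℓ = vertex-at q (≤∧≢⇒< i<ℓ 1+i≢ℓ)
      -- At the end of a block the quotient grows by one and the remainder returns to 0; `wrap`
      -- identifies the two descriptions of this vertex.
      ... | yes 1+i≡ℓ = begin
        vertex (suc i + q * ℓ)                  ≡⟨ cong (λ j → vertex (j + q * ℓ)) 1+i≡ℓ ⟩
        vertex (ℓ + q * ℓ)                      ≡⟨ vertex-at {0} (suc q) (<-trans (s≤s z≤n) 1<ℓ) ⟩
        ⟦ shift (+ suc q) (state 0) ⟧           ≡⟨ ⟦⟧-cong (≐-shift-shift (+ q) (+ 1) (state 0) (q+1≋1+q {q})) ⟨
        ⟦ shift (+ q) (shift (+ 1) (state 0)) ⟧ ≡⟨ ⟦⟧-cong (≐-shift (+ q) wrap) ⟨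
        ⟦ shift (+ q) (state ℓ) ⟧               ≡⟨ cong (λ j → ⟦ shift (+ q) (state j) ⟧) 1+i≡ℓ ⟨
        ⟦ shift (+ q) (state (suc i)) ⟧         ∎

    vertex-wrap : vertex (n * ℓ) ≡ vertex 0
    vertex-wrap = trans (vertex-at {0} n 0<ℓ) (trans (⟦⟧-cong (≐-shift-resp (state 0) n≋0)) (sym (vertex-at {0} 0 0<ℓ)))
      where 0<ℓ = <-trans (s≤s z≤n) 1<ℓ

    cycEdges-cycle : cycEdges cycle ≡ applyUpTo edge (n * ℓ)
    cycEdges-cycle = cycEdges-applyUpTo vertex (n * ℓ) vertex-wrap

    -- The quotient of an index below `n * ℓ` is below `n`, so its residue modulo `n` determines it.
    determined : ∀ {s t} → s < n * ℓ → t < n * ℓ → s % ℓ ≡ t % ℓ → + (s / ℓ) ≋ + (t / ℓ) → s ≡ t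
    determined {s} {t} s<nℓ t<nℓ %≡ /≋ = begin
      s                     ≡⟨ m≡m%n+[m/n]*n s ℓ ⟩
      s % ℓ + s / ℓ * ℓ     ≡⟨ cong₂ (λ i q → i + q * ℓ) %≡ (≋⇒≡ (m<n*o⇒m/o<n s<nℓ) (m<n*o⇒m/o<n t<nℓ) /≋) ⟩
      t % ℓ + t / ℓ * ℓ     ≡⟨ m≡m%n+[m/n]*n t ℓ ⟨
      t                     ∎
      where open ≡-Reasoning

    -- Translating both sets back by `s / ℓ` brings them into the form compared by `orbit`.
    vertex-injective : ∀ {s t} → s < n * ℓ → t < n * ℓ → vertex s ≡ vertex t → s ≡ t
    vertex-injective {s} {t} s<nℓ t<nℓ eq =
      determined s<nℓ t<nℓ (proj₁ same) (≋-sym (≋-linear (e (+ (t / ℓ)) (+ (s / ℓ))) (proj₂ same)))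
      where
      e : ∀ a b → a ℤ.- b ≡ (a ℤ.- b) ℤ.- + 0
      e = solve-∀
      unshift : ∀ L → shift (ℤ.- + (s / ℓ)) (shift (+ (s / ℓ)) L) ≐ L
      unshift L = ≐-trans (≐-shift-shift (ℤ.- + (s / ℓ)) (+ (s / ℓ)) L (≋-reflexive (ℤₚ.+-inverseˡ (+ (s / ℓ)))))
        ((λ {a} → ∈̃-resp L (≋-reflexive (sym (ℤₚ.+-identityʳ a))) ∘ ∈̃-shift⁻ (+ 0))
        , (λ {a} → ∈̃-shift⁺ (+ 0) ∘ ∈̃-resp L (≋-reflexive (ℤₚ.+-identityʳ a))))
      same : s % ℓ ≡ t % ℓ × + (t / ℓ) ℤ.- + (s / ℓ) ≋ + 0
      same = orbit (m%n<n s ℓ) (m%n<n t ℓ) (+ (t / ℓ) ℤ.- + (s / ℓ)) (≐-trans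
        (≐-trans (≐-sym (unshift (state (s % ℓ)))) (≐-shift (ℤ.- + (s / ℓ)) (⟦⟧-injective _ _ eq)))
        (≐-shift-shift (ℤ.- + (s / ℓ)) (+ (t / ℓ)) (state (t % ℓ))
          (≋-reflexive (ℤₚ.+-comm (ℤ.- + (s / ℓ)) (+ (t / ℓ))))))

    vertex-size : ∀ t → ∣ vertex t ∣ ≡ k
    vertex-size t = begin
      ∣ vertex t ∣                        ≡⟨ cong ∣_∣ (vertex-before t) ⟩
      ∣ ⟦ shift q (from i ∷ rest i) ⟧ ∣   ≡⟨ ∣⟦⟧∣ (shift-apart q (AllPairs.tail (apart i<ℓ))) ⟩
      suc (length (shift q (rest i)))     ≡⟨ cong suc (length-map (λ a → q ℤ.+ a) (rest i)) ⟩
      suc (length (rest i))               ≡⟨ size i<ℓ ⟩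
      k                                   ∎
      where
      open ≡-Reasoning
      i = t % ℓ
      q = + (t / ℓ)
      i<ℓ = m%n<n t ℓ

    edge-adjacent : ∀ t → Adjacent (vertex t) (vertex (suc t))
    edge-adjacent t rewrite vertex-before t | vertex-after t = Adjacent-⟦⟧ (shift-apart (+ (t / ℓ)) (apart (m%n<n t ℓ)))

    source target : ℕ → ℤ
    source t = + (t / ℓ) ℤ.+ from (t % ℓ)
    target t = + (t / ℓ) ℤ.+ to (t % ℓ)

    source≄target : ∀ t → source t ≄ target t
    source≄target t with shift-apart (+ (t / ℓ)) (apart (m%n<n t ℓ))
    ... | (t≄s ∷ _) ∷ _ = t≄s ∘ ≋-sym

    label-edge : ∀ t → label (edge t) ≡ ⁅ φ (source t) ⁆ ∪ ⁅ φ (target t) ⁆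
    label-edge t rewrite vertex-before t | vertex-after t =
      label-⟦⟧ (shift-apart (+ (t / ℓ)) (apart (m%n<n t ℓ)))

    target-source : ∀ t → target t ℤ.- source t ≡ to (t % ℓ) ℤ.- from (t % ℓ)
    target-source t = eq (+ (t / ℓ)) (to (t % ℓ)) (from (t % ℓ))
      where
      eq : ∀ q b a → (q ℤ.+ b) ℤ.- (q ℤ.+ a) ≡ b ℤ.- a
      eq = solve-∀

    -- Equal labels have differences in one class, hence belong to the same step. Then `from` and
    -- `to` cancel from the equality of sums, which leaves twice the two translations congruent, and
    -- 2 is invertible.
    label-injective : ∀ {s t} → s < n * ℓ → t < n * ℓ → label (edge s) ≡ label (edge t) → s ≡ t
    label-injective {s} {t} s<nℓ t<nℓ eq = determined s<nℓ t<nℓ i≡j (≋-halve (≋-linear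
        (e (+ (s / ℓ)) (+ (t / ℓ)) (from (t % ℓ)) (to (t % ℓ)))
        (subst (λ i → (+ (s / ℓ) ℤ.+ from i) ℤ.+ (+ (s / ℓ) ℤ.+ to i) ≋ source t ℤ.+ target t) i≡j (proj₂ same))))
      where
      e : ∀ p q a b → (p ℤ.+ p) ℤ.- (q ℤ.+ q) ≡
        ((p ℤ.+ a) ℤ.+ (p ℤ.+ b)) ℤ.- ((q ℤ.+ a) ℤ.+ (q ℤ.+ b))
      e = solve-∀
      same : (target s ℤ.- source s ∼ target t ℤ.- source t) × (source s ℤ.+ target s ≋ source t ℤ.+ target t)
      same = pair-difference-sum (source≄target s) (trans (sym (label-edge s)) (trans eq (label-edge t)))
      i≡j : s % ℓ ≡ t % ℓ
      i≡j = step-injective (m%n<n s ℓ) (m%n<n t ℓ)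
        (subst₂ _∼_ (target-source s) (target-source t) (proj₁ same))

    source-at : ∀ {i} q → i < ℓ → source (i + q * ℓ) ≡ + q ℤ.+ from i
    source-at q i<ℓ = cong₂ (λ p j → + p ℤ.+ from j) ([i+qℓ]/ℓ q i<ℓ) ([i+qℓ]%ℓ q i<ℓ)

    target-at : ∀ {i} q → i < ℓ → target (i + q * ℓ) ≡ + q ℤ.+ to i
    target-at q i<ℓ = cong₂ (λ p j → + p ℤ.+ to j) ([i+qℓ]/ℓ q i<ℓ) ([i+qℓ]%ℓ q i<ℓ)

    i+qℓ<nℓ : ∀ {i q} → i < ℓ → q < n → i + q * ℓ < n * ℓ
    i+qℓ<nℓ {i} {q} i<ℓ q<n = <-≤-trans (+-monoˡ-< (q * ℓ) i<ℓ) (*-monoˡ-≤ ℓ q<n)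

    label-at : ∀ {i a b} r → i < ℓ → r ℤ.+ from i ≋ a → r ℤ.+ to i ≋ b →
      ∃ λ t → t < n * ℓ × label (edge t) ≡ ⁅ φ a ⁆ ∪ ⁅ φ b ⁆
    label-at {i} r i<ℓ fr≋a to≋b = i + residue r * ℓ , i+qℓ<nℓ i<ℓ (residue<n r) ,
      trans (label-edge (i + residue r * ℓ)) (cong₂ (λ x y → ⁅ x ⁆ ∪ ⁅ y ⁆)
        (trans (cong φ (source-at (residue r) i<ℓ)) (φ-cong (≋-+ (residue-≋ r) ≋-refl ∙ fr≋a)))
        (trans (cong φ (target-at (residue r) i<ℓ)) (φ-cong (≋-+ (residue-≋ r) ≋-refl ∙ to≋b))))

    -- The class of `b - a` selects the step, and translation by `a - from i` moves its source onto
    -- `a`.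
    label-surjective : ∀ x y → x ≢ y → ∃ λ t → t < n * ℓ × label (edge t) ≡ ⁅ x ⁆ ∪ ⁅ y ⁆
    label-surjective x y x≢y with φ-surjective x | φ-surjective y
    ... | a , refl | b , refl with step-surjective (b ℤ.- a) (λ b-a≋0 → x≢y (φ-cong (≋-sym (≋-linear (eq a b) b-a≋0))))
      where
      eq : ∀ a b → b ℤ.- a ≡ (b ℤ.- a) ℤ.- + 0
      eq = solve-∀
    ...   | i , i<ℓ , inj₁ b-a≋ = label-at (a ℤ.- from i) i<ℓ
              (≋-reflexive (eq₁ a (from i))) (≋-sym (≋-linear (eq₂ a b (from i) (to i)) b-a≋))
      where
      eq₁ : ∀ a f → (a ℤ.- f) ℤ.+ f ≡ a
      eq₁ = solve-∀
      eq₂ : ∀ a b f t → b ℤ.- ((a ℤ.- f) ℤ.+ t) ≡ (b ℤ.- a) ℤ.- (t ℤ.- f)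
      eq₂ = solve-∀
    -- The step runs the other way: translation takes `from i` to `b` and `to i` to `a`, and the
    -- label is read in reverse.
    ...   | i , i<ℓ , inj₂ b-a≋ with label-at {i} {b} {a} (b ℤ.- from i) i<ℓ
              (≋-reflexive (eq₁ b (from i))) (≋-linear (eq₂ a b (from i) (to i)) b-a≋)
      where
      eq₁ : ∀ a f → (a ℤ.- f) ℤ.+ f ≡ a
      eq₁ = solve-∀
      eq₂ : ∀ a b f t → ((b ℤ.- f) ℤ.+ t) ℤ.- a ≡ (b ℤ.- a) ℤ.- ℤ.- (t ℤ.- f)
      eq₂ = solve-∀
    ...     | t , t<nℓ , eq = t , t<nℓ , trans eq (∪-comm ⁅ φ b ⁆ ⁅ φ a ⁆)

    edge-of : ∀ {A B} → (A , B) ∈ᴸ cycEdges cycle → ∃ λ t → A ≡ vertex t × B ≡ vertex (suc t)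
    edge-of AB∈ = let t , _ , eq = ∈-applyUpTo⁻ edge (subst (_ ∈ᴸ_) cycEdges-cycle AB∈)
      in t , cong proj₁ eq , cong proj₂ eq

    cycle-isCycle : IsCycle n k cycle
    cycle-isCycle = record
      { long     = subst (3 ≤_) (sym (length-applyUpTo vertex (n * ℓ)))
                     (≤-trans (s≤s (≤-trans 1<ℓ (m≤m+n ℓ ℓ))) (m≤m*n n ℓ))
      ; vertices = All.applyUpTo⁺₂ vertex (n * ℓ) vertex-size
      ; distinct = Unique.applyUpTo⁺₁ vertex (n * ℓ)
                     λ i<j j<nℓ eq → <⇒≢ i<j (vertex-injective (<-trans i<j j<nℓ) j<nℓ eq)
      ; adjacent = subst (All _) (sym cycEdges-cycle) (All.applyUpTo⁺₂ edge (n * ℓ) edge-adjacent)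
      }

    cycle-isRainbow : IsRainbowCycle n k cycle
    cycle-isRainbow = cycle-isCycle , λ x y x≢y →
      let t , t<nℓ , label≡ = label-surjective x y x≢y
          L? = λ e → label e ≟ˢ (⁅ x ⁆ ∪ ⁅ y ⁆)
      in trans (cong (length ∘ filter L?) cycEdges-cycle)
           (length-filter-applyUpTo L? edge (n * ℓ) t<nℓ label≡
             λ s<nℓ eq → label-injective s<nℓ t<nℓ (trans eq (sym label≡)))

-- Two-element subsets

m+m-injective : ∀ {a b} → a + a ≡ b + b → a ≡ b
m+m-injective {a} {b} eq = trans (n≡⌊n+n/2⌋ a) (trans (cong ⌊_/2⌋ eq) (sym (n≡⌊n+n/2⌋ b)))

half : ∀ m → ∃ λ h → m ≡ h + h ⊎ m ≡ suc (h + h)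
half zero = 0 , inj₁ refl
half (suc m) with half m
... | h , inj₁ m≡ = h , inj₂ (cong suc m≡)
... | h , inj₂ m≡ = suc h , inj₁ (trans (cong suc m≡) (cong suc (sym (+-suc h h))))

∣p∣≡0⇒p≡∅ : ∀ {n} (p : Subset n) → ∣ p ∣ ≡ 0 → p ≡ ∅
∣p∣≡0⇒p≡∅ []          _  = refl
∣p∣≡0⇒p≡∅ (false ∷ p) eq = cong (false ∷_) (∣p∣≡0⇒p≡∅ p eq)

∣p∣≡1⇒singleton : ∀ {n} (p : Subset n) → ∣ p ∣ ≡ 1 → ∃ λ x → p ≡ ⁅ x ⁆
∣p∣≡1⇒singleton (true  ∷ p) eq = Fin.zero , cong (true ∷_) (∣p∣≡0⇒p≡∅ p (suc-injective eq))
∣p∣≡1⇒singleton (false ∷ p) eq with ∣p∣≡1⇒singleton p eq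
... | x , p≡x = Fin.suc x , cong (false ∷_) p≡x

∣p∣≡2⇒pair : ∀ {n} (p : Subset n) → ∣ p ∣ ≡ 2 → ∃₂ λ x y → x ≢ y × p ≡ ⁅ x ⁆ ∪ ⁅ y ⁆
∣p∣≡2⇒pair (true  ∷ p) eq with ∣p∣≡1⇒singleton p (suc-injective eq)
... | y , p≡y = Fin.zero , Fin.suc y , (λ ()) , cong (true ∷_) (trans p≡y (sym (∪-identityˡ ⁅ y ⁆)))
∣p∣≡2⇒pair (false ∷ p) eq with ∣p∣≡2⇒pair p eq
... | x , y , x≢y , p≡xy = Fin.suc x , Fin.suc y , x≢y ∘ Fin-suc-injective , cong (false ∷_) p≡xy

-- A case distinction that takes the decision as an argument, so that known cases can be rewritten
-- with `pick-yes` and `pick-no`.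
pick : ∀ {P A : Set} → Dec P → A → A → A
pick (yes _) a b = a
pick (no  _) a b = b

pick-yes : ∀ {P A : Set} (P? : Dec P) {a b : A} → P → pick P? a b ≡ a
pick-yes (yes _) _ = refl
pick-yes (no ¬p) p = ⊥-elim (¬p p)

pick-no : ∀ {P A : Set} (P? : Dec P) {a b : A} → ¬ P → pick P? a b ≡ b
pick-no (yes p) ¬p = ⊥-elim (¬p p)
pick-no (no _)  _  = refl

signed : Bool → ℤ → ℤ
signed true  a = a
signed false a = ℤ.- a

-- Each step keeps one element, `hub i`. By `turn` the two ends of a step, as pairs, have
-- differences in distinct classes, which prevents reflection from reversing an edge.
module Mirrored (ℓ : ℕ) .{{_ : NonZero ℓ}} (1<ℓ : 1 < ℓ) (κ : Modular.Coordinate ℓ) (block : Modular.Block ℓ 2)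
  (hub : ℕ → ℤ) (rest≡hub : ∀ i → Modular.Block.rest block i ≡ hub i ∷ [])
  (turn : ∀ {i} → i < ℓ →
    ¬ Modular._∼_ ℓ (hub i ℤ.- Modular.Block.from block i) (hub i ℤ.- Modular.Block.to block i)) where

  open Modular ℓ

  private
    module C = Cycle 1<ℓ block κ
    module D = Cycle 1<ℓ block (mirror κ)
  open Realisation κ
  open Block block

  apart-hub : ∀ {i} → i < ℓ → Apart (to i ∷ from i ∷ hub i ∷ [])
  apart-hub {i} i<ℓ = subst (λ L → Apart (to i ∷ from i ∷ L)) (rest≡hub i) (apart i<ℓ)

  label-comm : ∀ (A B : Subset n) → label (A , B) ≡ label (B , A)
  label-comm A B = ∪-comm (A ─ B) (B ─ A)

  -- Reflection preserves differences up to sign, so a common label sits at the same place of the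
  -- block in both cycles.
  same-step : ∀ s t → label (C.edge s) ≡ label (D.edge t) → s % ℓ ≡ t % ℓ
  same-step s t eq = step-injective (m%n<n s ℓ) (m%n<n t ℓ)
    (subst (_∼ _) (C.target-source s) (∼-trans
      (proj₁ (pair-difference-sum {c = ℤ.- C.source t} {ℤ.- C.target t} (C.source≄target s)
        (trans (sym (C.label-edge s)) (trans eq (D.label-edge t)))))
      (inj₂ (≋-reflexive (trans (e (D.target t) (D.source t)) (cong ℤ.-_ (D.target-source t)))))))
    where
    e : ∀ a b → ℤ.- a ℤ.- ℤ.- b ≡ ℤ.- (a ℤ.- b)
    e = solve-∀

  centre : ℕ → ℤ
  centre t = + (t / ℓ) ℤ.+ hub (t % ℓ)

  source≄centre : ∀ t → C.source t ≄ centre t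
  source≄centre t with shift-apart (+ (t / ℓ)) (apart-hub (m%n<n t ℓ))
  ... | _ ∷ (s≄c ∷ _) ∷ _ = s≄c

  target≄centre : ∀ t → C.target t ≄ centre t
  target≄centre t with shift-apart (+ (t / ℓ)) (apart-hub (m%n<n t ℓ))
  ... | (_ ∷ t≄c ∷ _) ∷ _ = t≄c

  ⟦⟧-pair : ∀ a b → ⟦ a ∷ b ∷ [] ⟧ ≡ ⁅ φ a ⁆ ∪ ⁅ φ b ⁆
  ⟦⟧-pair a b = cong (⁅ φ a ⁆ ∪_) (∪-identityʳ ⁅ φ b ⁆)

  ⟦⟧-shift-rest : ∀ κ′ (move : ℕ → ℤ) t →
    Realisation.⟦_⟧ κ′ (shift (+ (t / ℓ)) (move (t % ℓ) ∷ rest (t % ℓ))) ≡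
    Realisation.⟦_⟧ κ′ (shift (+ (t / ℓ)) (move (t % ℓ) ∷ hub (t % ℓ) ∷ []))
  ⟦⟧-shift-rest κ′ move t =
    cong (λ L → Realisation.⟦_⟧ κ′ (shift (+ (t / ℓ)) (move (t % ℓ) ∷ L))) (rest≡hub (t % ℓ))

  C-before : ∀ t → C.vertex t ≡ ⁅ φ (C.source t) ⁆ ∪ ⁅ φ (centre t) ⁆
  C-before t = trans (C.vertex-before t)
    (trans (⟦⟧-shift-rest κ from t) (⟦⟧-pair (C.source t) (centre t)))

  C-after : ∀ t → C.vertex (suc t) ≡ ⁅ φ (C.target t) ⁆ ∪ ⁅ φ (centre t) ⁆
  C-after t = trans (C.vertex-after t)
    (trans (⟦⟧-shift-rest κ to t) (⟦⟧-pair (C.target t) (centre t)))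

  D-before : ∀ t → D.vertex t ≡ ⁅ φ (ℤ.- C.source t) ⁆ ∪ ⁅ φ (ℤ.- centre t) ⁆
  D-before t = trans (D.vertex-before t)
    (trans (⟦⟧-shift-rest (mirror κ) from t) (⟦⟧-pair (ℤ.- C.source t) (ℤ.- centre t)))

  D-after : ∀ t → D.vertex (suc t) ≡ ⁅ φ (ℤ.- C.target t) ⁆ ∪ ⁅ φ (ℤ.- centre t) ⁆
  D-after t = trans (D.vertex-after t)
    (trans (⟦⟧-shift-rest (mirror κ) to t) (⟦⟧-pair (ℤ.- C.target t) (ℤ.- centre t)))

  -- Subtracting the sums of the elements of the two endpoints gives from − to ≋ to − from.
  no-common-edge : ∀ s t → C.vertex s ≡ D.vertex t → C.vertex (suc s) ≢ D.vertex (suc t)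
  no-common-edge s t eq eq′ = from≄to (≋-halve (≋-linear
      (e (+ (s / ℓ)) q (from (s % ℓ)) (to (s % ℓ)) (hub (s % ℓ))) (≋-- (reindex from sum) (reindex to sum′))))
    where
    q = + (t / ℓ)
    i≡ : s % ℓ ≡ t % ℓ
    i≡ = same-step s t (cong₂ (λ A B → label (A , B)) eq eq′)
    reindex : ∀ (move : ℕ → ℤ) {a} → a ≋ ℤ.- (q ℤ.+ move (t % ℓ)) ℤ.+ ℤ.- (q ℤ.+ hub (t % ℓ)) →
      a ≋ ℤ.- (q ℤ.+ move (s % ℓ)) ℤ.+ ℤ.- (q ℤ.+ hub (s % ℓ))
    reindex move {a} = subst (λ i → a ≋ ℤ.- (q ℤ.+ move i) ℤ.+ ℤ.- (q ℤ.+ hub i)) (sym i≡)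
    sum : C.source s ℤ.+ centre s ≋ ℤ.- C.source t ℤ.+ ℤ.- centre t
    sum = proj₂ (pair-difference-sum {c = ℤ.- C.source t} {ℤ.- centre t} (source≄centre s)
      (trans (sym (C-before s)) (trans eq (D-before t))))
    sum′ : C.target s ℤ.+ centre s ≋ ℤ.- C.target t ℤ.+ ℤ.- centre t
    sum′ = proj₂ (pair-difference-sum {c = ℤ.- C.target t} {ℤ.- centre t} (target≄centre s)
      (trans (sym (C-after s)) (trans eq′ (D-after t))))
    from≄to : from (s % ℓ) ≄ to (s % ℓ)
    from≄to with apart-hub (m%n<n s ℓ)
    ... | (t≄f ∷ _) ∷ _ = t≄f ∘ ≋-sym
    e : ∀ p q f t h → f ℤ.+ f ℤ.- (t ℤ.+ t) ≡
      ((p ℤ.+ f) ℤ.+ (p ℤ.+ h)) ℤ.- ((p ℤ.+ t) ℤ.+ (p ℤ.+ h)) ℤ.-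
      ((ℤ.- (q ℤ.+ f) ℤ.+ ℤ.- (q ℤ.+ h)) ℤ.- (ℤ.- (q ℤ.+ t) ℤ.+ ℤ.- (q ℤ.+ h)))
    e = solve-∀

  -- Comparing the pairs `C.vertex s` and `D.vertex (suc t)` by their differences would put
  -- `hub - from` and `hub - to` of one step into the same class, against `turn`.
  no-reversed-edge : ∀ s t → C.vertex s ≡ D.vertex (suc t) → C.vertex (suc s) ≢ D.vertex t
  no-reversed-edge s t eq eq′ = turn (m%n<n s ℓ) (∼-trans
      (inj₁ (≋-reflexive (sym (e₁ (+ (s / ℓ)) (hub (s % ℓ)) (from (s % ℓ))))))
      (∼-trans (proj₁ (pair-difference-sum {c = ℤ.- C.target t} {ℤ.- centre t} (source≄centre s)
      (trans (sym (C-before s)) (trans eq (D-after t)))))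
      (inj₂ (≋-reflexive (trans (e₂ (+ (t / ℓ)) (hub (t % ℓ)) (to (t % ℓ)))
        (cong (λ i → ℤ.- (hub i ℤ.- to i)) (sym i≡)))))))
    where
    i≡ : s % ℓ ≡ t % ℓ
    i≡ = same-step s t (trans (cong₂ (λ A B → label (A , B)) eq eq′) (label-comm (D.vertex (suc t)) (D.vertex t)))
    e₁ : ∀ q h f → (q ℤ.+ h) ℤ.- (q ℤ.+ f) ≡ h ℤ.- f
    e₁ = solve-∀
    e₂ : ∀ q h f → ℤ.- (q ℤ.+ h) ℤ.- ℤ.- (q ℤ.+ f) ≡ ℤ.- (h ℤ.- f)
    e₂ = solve-∀

  edge-disjoint : EdgeDisjoint (Cycle.cycle 1<ℓ block κ) (Cycle.cycle 1<ℓ block (mirror κ))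
  edge-disjoint A B (inj₁ AB∈C) (inj₁ AB∈D) =
    let s , A≡ , B≡ = C.edge-of AB∈C
        t , A≡′ , B≡′ = D.edge-of AB∈D
    in no-common-edge s t (trans (sym A≡) A≡′) (trans (sym B≡) B≡′)
  edge-disjoint A B (inj₂ BA∈C) (inj₂ BA∈D) = edge-disjoint B A (inj₁ BA∈C) (inj₁ BA∈D)
  edge-disjoint A B (inj₁ AB∈C) (inj₂ BA∈D) =
    let s , A≡ , B≡ = C.edge-of AB∈C
        t , B≡′ , A≡′ = D.edge-of BA∈D
    in no-reversed-edge s t (trans (sym A≡) A≡′) (trans (sym B≡) B≡′)
  edge-disjoint A B (inj₂ BA∈C) (inj₁ AB∈D) = edge-disjoint B A (inj₁ BA∈C) (inj₂ AB∈D)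

-- The block of pairs {0, x i}

module Pairs (p j : ℕ) (0<p : 0 < p) (0<j : 0 < j) (j<ℓ : j < suc p)
  (j-half : j + j ≡ suc p ⊎ suc (j + j) ≡ suc p) where

  ℓ : ℕ
  ℓ = suc p

  open Modular ℓ hiding (n)
  n = Modular.n ℓ

  double : ℕ → ℤ
  double a = + (a + a)

  small-sum : ∀ {a b} → 0 < a → a ≤ ℓ → b ≤ ℓ → + a ≄ ℤ.- + b
  small-sum {suc a} {b} _ a≤ℓ b≤ℓ a≋-b = case ≋⇒≡ (s≤s (+-mono-≤ a≤ℓ b≤ℓ)) (s≤s z≤n) (≋-linear (eq (+ suc a) (+ b)) a≋-b) of λ ()
    where
    eq : ∀ a b → a ℤ.+ b ℤ.- + 0 ≡ a ℤ.- ℤ.- b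
    eq = solve-∀

  ≋-halve-neg : ∀ {a b} → a ℤ.+ a ≋ ℤ.- (b ℤ.+ b) → a ≋ ℤ.- b
  ≋-halve-neg {a} {b} = ≋-halve ∘ ≋-linear (eq a b)
    where
    eq : ∀ a b → a ℤ.+ a ℤ.- (ℤ.- b ℤ.+ ℤ.- b) ≡ a ℤ.+ a ℤ.- ℤ.- (b ℤ.+ b)
    eq = solve-∀

  ℓ<n : ∀ {a} → a ≤ ℓ → a < n
  ℓ<n a≤ℓ = s≤s (≤-trans a≤ℓ (m≤m+n ℓ ℓ))

  double-injective : ∀ {a b} → 0 < a → a ≤ ℓ → b ≤ ℓ → double a ∼ double b → a ≡ b
  double-injective 0<a a≤ℓ b≤ℓ (inj₁ eq) = ≋⇒≡ (ℓ<n a≤ℓ) (ℓ<n b≤ℓ) (≋-halve eq)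
  double-injective 0<a a≤ℓ b≤ℓ (inj₂ eq) = ⊥-elim (small-sum 0<a a≤ℓ b≤ℓ (≋-halve-neg eq))

  double≄0 : ∀ {a} → 0 < a → a ≤ ℓ → double a ≄ + 0
  double≄0 {suc a} _ a≤ℓ eq = case ≋⇒≡ (ℓ<n a≤ℓ) (s≤s z≤n) (≋-halve {+ suc a} {+ 0} eq) of λ ()

  halved : ∀ d → ∃ λ h → h < n × d ≋ + h ℤ.+ + h
  halved d = residue d/2 , residue<n d/2 ,
    ≋-sym (≋-+ (residue-≋ d/2) (residue-≋ d/2) ∙ mod (divides d (eq d (+ ℓ))))
    where
    -- The inverse of 2 modulo `n` is 1 + ℓ, because 2(1 + ℓ) = n + 1.
    d/2 = d ℤ.* (+ 1 ℤ.+ + ℓ)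
    eq : ∀ d l → d ℤ.* (+ 1 ℤ.+ l) ℤ.+ d ℤ.* (+ 1 ℤ.+ l) ℤ.- d ≡ d ℤ.* (+ 1 ℤ.+ (l ℤ.+ l))
    eq = solve-∀

  complement-double : ∀ a b {d} → a + b ≡ n → d ≋ + a ℤ.+ + a → d ≋ ℤ.- (+ b ℤ.+ + b)
  complement-double a b eq d≋ =
    d≋ ∙ ≋-+ (≋-complement a b eq) (≋-complement a b eq) ∙ ≋-reflexive (sym (ℤₚ.neg-distrib-+ (+ b) (+ b)))

  double-surjective : ∀ d → d ≄ + 0 → ∃ λ i → i < ℓ × d ∼ double (suc i)
  double-surjective d d≄0 = go (halved d)
    where
    go : (∃ λ h → h < n × d ≋ + h ℤ.+ + h) → ∃ λ i → i < ℓ × d ∼ double (suc i)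
    go (zero  , _ , d≋) = ⊥-elim (d≄0 d≋)
    go (suc h , s≤s h<2ℓ , d≋) with suc h ≤? ℓ | m≤n⇒∃[o]m+o≡n h<2ℓ
    ... | yes h<ℓ | _ = h , h<ℓ , inj₁ d≋
    ... | no  h≮ℓ | o , 1+h+o≡2ℓ =
      o , +-cancelˡ-< (suc h) o ℓ (subst (_< suc h + ℓ) (sym 1+h+o≡2ℓ) (+-monoˡ-< ℓ (≰⇒> h≮ℓ))) ,
      inj₂ (complement-double (suc h) (suc o) (trans (+-suc (suc h) o) (cong suc 1+h+o≡2ℓ)) d≋)

  -- The number 4m + 2, written as twice an odd number so that halving applies.
  δ : ℕ → ℤ
  δ m = + suc (m + m) ℤ.+ + suc (m + m)

  odd<n : ∀ {m} → m < ℓ → suc (m + m) < n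
  odd<n m<ℓ = s≤s (+-mono-<-≤ m<ℓ (<⇒≤ m<ℓ))

  -- For opposite signs, halving gives 2a + 1 ≋ -(2b + 1), and halving 2(1 + a) ≋ -2b then gives 1 +
  -- a ≋ -b, impossible because 1 + a + b lies strictly between 0 and `n`.
  δ-injective : ∀ {a b} → a < ℓ → b < ℓ → δ a ∼ δ b → a ≡ b
  δ-injective a<ℓ b<ℓ (inj₁ eq) = m+m-injective (suc-injective (≋⇒≡ (odd<n a<ℓ) (odd<n b<ℓ) (≋-halve eq)))
  δ-injective {a} {b} a<ℓ b<ℓ (inj₂ eq) = ⊥-elim (small-sum (s≤s z≤n) a<ℓ (<⇒≤ b<ℓ)
      (≋-halve (≋-linear (e (+ a) (+ b)) (≋-halve-neg {+ suc (a + a)} {+ suc (b + b)} eq))))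
    where
    e : ∀ a b → (+ 1 ℤ.+ a) ℤ.+ (+ 1 ℤ.+ a) ℤ.- (ℤ.- b ℤ.+ ℤ.- b) ≡ + 1 ℤ.+ (a ℤ.+ a) ℤ.- ℤ.- (+ 1 ℤ.+ (b ℤ.+ b))
    e = solve-∀

  -- Write `d` as 2h with `h` a residue. An odd `h` has the required form; an even nonzero `h` is
  -- replaced by n - h, which is odd, at the cost of a sign.
  δ-surjective : ∀ d → d ≄ + 0 → ∃ λ m → m < ℓ × d ∼ δ m
  δ-surjective d d≄0 = go (halved d)
    where
    e : ∀ g o → (g + g) + suc (o + o) ≡ suc ((g + o) + (g + o))
    e = ℕ.solve-∀
    go : (∃ λ h → h < n × d ≋ + h ℤ.+ + h) → ∃ λ m → m < ℓ × d ∼ δ m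
    go (h , s≤s h≤2ℓ , d≋) with half h
    ... | zero  , inj₁ refl = ⊥-elim (d≄0 d≋)
    ... | g     , inj₂ refl = g , ≰⇒> (λ ℓ≤g → <⇒≱ h≤2ℓ (+-mono-≤ ℓ≤g ℓ≤g)) , inj₁ d≋
    ... | suc g , inj₁ refl with m≤n⇒∃[o]m+o≡n {suc g} {ℓ} (≮⇒≥ λ ℓ<g → <⇒≱ (+-mono-< ℓ<g ℓ<g) h≤2ℓ)
    ...   | o , 1+g+o≡ℓ = o , subst (o <_) 1+g+o≡ℓ (s≤s (m≤n+m o g)) ,
      inj₂ (complement-double (suc g + suc g) (suc (o + o)) (trans (e (suc g) o) (cong (λ m → suc (m + m)) 1+g+o≡ℓ)) d≋)

  -- Alternation turns differences of neighbours into sums. The one repetition, on entering `j`,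
  -- produces 2 = `δ 0` instead of `δ j`, which is left to the last step of the block. Starting with
  -- `false` makes `x 0` equal to -2, as `wrap` requires.
  sign : ℕ → Bool
  sign zero    = false
  sign (suc i) = pick (suc i ≟ j) (sign i) (not (sign i))

  x : ℕ → ℤ
  x i = signed (sign i) (double (suc i))

  signed∼ : ∀ b a → signed b a ∼ a
  signed∼ true  a = inj₁ ≋-refl
  signed∼ false a = inj₂ ≋-refl

  x∼double : ∀ i → x i ∼ double (suc i)
  x∼double i = signed∼ (sign i) (double (suc i))

  x-injective : ∀ {i j} → i < ℓ → j < ℓ → x i ∼ x j → i ≡ j
  x-injective i<ℓ j<ℓ eq = suc-injective (double-injective (s≤s z≤n) i<ℓ j<ℓ
    (∼-trans (∼-sym (x∼double _)) (∼-trans eq (x∼double _))))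

  ∼0⇒≋0 : ∀ {a} → a ∼ + 0 → a ≋ + 0
  ∼0⇒≋0 (inj₁ eq) = eq
  ∼0⇒≋0 (inj₂ eq) = eq

  x≄0 : ∀ {i} → i < ℓ → x i ≄ + 0
  x≄0 i<ℓ eq = double≄0 (s≤s z≤n) i<ℓ (∼0⇒≋0 (∼-trans (∼-sym (x∼double _)) (inj₁ eq)))

  -- The number 4j + 2 is n + 1 if 2j = ℓ, and n - 1 if 2j + 1 = ℓ. This fixes the place `j`.
  1∼δj : + 1 ∼ δ j
  1∼δj = [ even , odd ]′ j-half
    where
    e : ∀ l → (+ 1 ℤ.+ l) ℤ.+ (+ 1 ℤ.+ l) ℤ.- + 1 ≡ + 1 ℤ.+ (l ℤ.+ l) ℤ.- + 0
    e = solve-∀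
    even : j + j ≡ ℓ → + 1 ∼ δ j
    even 2j≡ℓ = inj₁ (≋-sym (≋-reflexive (cong (λ m → + suc m ℤ.+ + suc m) 2j≡ℓ) ∙ ≋-linear (e (+ ℓ)) n≋0))
    odd : suc (j + j) ≡ ℓ → + 1 ∼ δ j
    odd 2j+1≡ℓ = inj₂ (≋-complement 1 (suc (j + j) + suc (j + j)) (cong (λ m → suc (m + m)) 2j+1≡ℓ))

  xp∼1 : x p ∼ + 1
  xp∼1 = ∼-trans (x∼double p) (inj₂ (≋-complement (ℓ + ℓ) 1 (+-comm (ℓ + ℓ) 1)))

  -- Step `i` has class `δ (π i)`. This is the successor map, except that the place before `j` gets
  -- 0 and the last place `p` gets `j`; hence it permutes the indices below `ℓ`.
  π : ℕ → ℕ
  π i = pick (i ≟ p) j (pick (suc i ≟ j) 0 (suc i))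

  x-step : ∀ i → x (suc i) ℤ.- x i ∼ δ (pick (suc i ≟ j) 0 (suc i))
  x-step i with suc i ≟ j
  ... | yes _ = ∼-trans (same (sign i) (+ suc (suc i)) (+ suc i)) (inj₁ (≋-reflexive (e (+ i))))
    where
    same : ∀ b c a → signed b (c ℤ.+ c) ℤ.- signed b (a ℤ.+ a) ∼ (c ℤ.+ c) ℤ.- (a ℤ.+ a)
    same true  c a = inj₁ ≋-refl
    same false c a = inj₂ (≋-reflexive (eq c a))
      where
      eq : ∀ c a → ℤ.- (c ℤ.+ c) ℤ.- ℤ.- (a ℤ.+ a) ≡ ℤ.- ((c ℤ.+ c) ℤ.- (a ℤ.+ a))
      eq = solve-∀
    e : ∀ i → (+ 2 ℤ.+ i) ℤ.+ (+ 2 ℤ.+ i) ℤ.- ((+ 1 ℤ.+ i) ℤ.+ (+ 1 ℤ.+ i)) ≡ + 2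
    e = solve-∀
  ... | no  _ = ∼-trans (alternate (sign i) (+ suc (suc i)) (+ suc i)) (inj₁ (≋-reflexive (e (+ i))))
    where
    alternate : ∀ b c a → signed (not b) (c ℤ.+ c) ℤ.- signed b (a ℤ.+ a) ∼ (c ℤ.+ c) ℤ.+ (a ℤ.+ a)
    alternate false c a = inj₁ (≋-reflexive (eq c a))
      where
      eq : ∀ c a → (c ℤ.+ c) ℤ.- ℤ.- (a ℤ.+ a) ≡ (c ℤ.+ c) ℤ.+ (a ℤ.+ a)
      eq = solve-∀
    alternate true c a = inj₂ (≋-reflexive (eq c a))
      where
      eq : ∀ c a → ℤ.- (c ℤ.+ c) ℤ.- (a ℤ.+ a) ≡ ℤ.- ((c ℤ.+ c) ℤ.+ (a ℤ.+ a))
      eq = solve-∀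
    e : ∀ i → (+ 2 ℤ.+ i) ℤ.+ (+ 2 ℤ.+ i) ℤ.+ ((+ 1 ℤ.+ i) ℤ.+ (+ 1 ℤ.+ i)) ≡
      (+ 1 ℤ.+ ((+ 1 ℤ.+ i) ℤ.+ (+ 1 ℤ.+ i))) ℤ.+ (+ 1 ℤ.+ ((+ 1 ℤ.+ i) ℤ.+ (+ 1 ℤ.+ i)))
    e = solve-∀

  π-end : π p ≡ j
  π-end = pick-yes (p ≟ p) refl

  π-same : ∀ {i} → i < p → suc i ≡ j → π i ≡ 0
  π-same {i} i<p 1+i≡j = trans (pick-no (i ≟ p) (<⇒≢ i<p)) (pick-yes (suc i ≟ j) 1+i≡j)

  π-other : ∀ {i} → i < p → suc i ≢ j → π i ≡ suc i
  π-other {i} i<p 1+i≢j = trans (pick-no (i ≟ p) (<⇒≢ i<p)) (pick-no (suc i ≟ j) 1+i≢j)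

  π-inner : ∀ {i} → i < p → π i ≡ pick (suc i ≟ j) 0 (suc i)
  π-inner {i} i<p = pick-no (i ≟ p) (<⇒≢ i<p)

  π⁻¹ : ℕ → ℕ
  π⁻¹ m = pick (m ≟ 0) (pred j) (pick (m ≟ j) p (pred m))

  j≢0 : j ≢ 0
  j≢0 j≡0 = <⇒≢ 0<j (sym j≡0)

  π⁻¹-π : ∀ {i} → i < ℓ → π⁻¹ (π i) ≡ i
  π⁻¹-π {i} i<ℓ with m<1+n⇒m<n∨m≡n i<ℓ
  ... | inj₂ refl = trans (cong π⁻¹ π-end) (trans (pick-no (j ≟ 0) j≢0) (pick-yes (j ≟ j) refl))
  ... | inj₁ i<p  = [ (λ 1+i≡j → trans (cong π⁻¹ (π-same i<p 1+i≡j)) (cong pred (sym 1+i≡j)))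
                    , (λ 1+i≢j → trans (cong π⁻¹ (π-other i<p 1+i≢j)) (pick-no (suc i ≟ j) 1+i≢j)) ]′
                    (toSum (suc i ≟ j))

  π-bound : ∀ {i} → i < ℓ → π i < ℓ
  π-bound {i} i<ℓ with m<1+n⇒m<n∨m≡n i<ℓ
  ... | inj₂ refl = subst (_< ℓ) (sym π-end) j<ℓ
  ... | inj₁ i<p  = [ (λ 1+i≡j → subst (_< ℓ) (sym (π-same i<p 1+i≡j)) (s≤s z≤n))
                    , (λ 1+i≢j → subst (_< ℓ) (sym (π-other i<p 1+i≢j)) (s≤s i<p)) ]′
                    (toSum (suc i ≟ j))

  π-surjective : ∀ m → m < ℓ → ∃ λ i → i < ℓ × π i ≡ m
  π-surjective zero _ = pred j , m<n⇒m<1+n pred-j<p , π-same pred-j<p suc-pred-j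
    where
    suc-pred-j : suc (pred j) ≡ j
    suc-pred-j = suc-pred j {{≢-nonZero j≢0}}
    pred-j<p : pred j < p
    pred-j<p = subst (_≤ p) (sym suc-pred-j) (m<1+n⇒m≤n j<ℓ)
  π-surjective (suc i) (s≤s i<p) =
    [ (λ 1+i≡j → p , ≤-refl , trans π-end (sym 1+i≡j))
    , (λ 1+i≢j → i , m<n⇒m<1+n i<p , π-other i<p 1+i≢j) ]′ (toSum (suc i ≟ j))

  state : ℕ → List ℤ
  state i = pick (i ≟ ℓ) (x p ∷ ℤ.- x p ∷ []) (+ 0 ∷ x i ∷ [])

  hub from to : ℕ → ℤ
  hub  i = pick (i ≟ p) (x p) (+ 0)
  from i = pick (i ≟ p) (+ 0) (x i)
  to   i = pick (i ≟ p) (ℤ.- x p) (x (suc i))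

  state-end : state ℓ ≡ x p ∷ ℤ.- x p ∷ []
  state-end = pick-yes (ℓ ≟ ℓ) refl

  state-inner : ∀ {i} → i < ℓ → state i ≡ + 0 ∷ x i ∷ []
  state-inner {i} i<ℓ = pick-no (i ≟ ℓ) (<⇒≢ i<ℓ)

  hub-end : hub p ≡ x p
  hub-end = pick-yes (p ≟ p) refl

  from-end : from p ≡ + 0
  from-end = pick-yes (p ≟ p) refl

  to-end : to p ≡ ℤ.- x p
  to-end = pick-yes (p ≟ p) refl

  module _ {i : ℕ} (i<p : i < p) where
    hub-inner : hub i ≡ + 0
    hub-inner = pick-no (i ≟ p) (<⇒≢ i<p)
    from-inner : from i ≡ x i
    from-inner = pick-no (i ≟ p) (<⇒≢ i<p)
    to-inner : to i ≡ x (suc i)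
    to-inner = pick-no (i ≟ p) (<⇒≢ i<p)

  pair≐ : ∀ {a b c d} → a ≋ c → b ≋ d → a ∷ b ∷ [] ≐ c ∷ d ∷ []
  pair≐ a≋c b≋d = (λ { (here e) → here (e ∙ a≋c) ; (there (here e)) → there (here (e ∙ b≋d)) })
                , (λ { (here e) → here (e ∙ ≋-sym a≋c) ; (there (here e)) → there (here (e ∙ ≋-sym b≋d)) })

  swap≐ : ∀ {a b c d} → a ≋ d → b ≋ c → a ∷ b ∷ [] ≐ c ∷ d ∷ []
  swap≐ a≋d b≋c = (λ { (here e) → there (here (e ∙ a≋d)) ; (there (here e)) → here (e ∙ b≋c) })
                , (λ { (here e) → there (here (e ∙ ≋-sym b≋c)) ; (there (here e)) → here (e ∙ ≋-sym a≋d) })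

  before : ∀ {i} → i < ℓ → state i ≐ from i ∷ hub i ∷ []
  before {i} i<ℓ with m<1+n⇒m<n∨m≡n i<ℓ
  ... | inj₁ i<p rewrite state-inner i<ℓ | from-inner i<p | hub-inner i<p = swap≐ ≋-refl ≋-refl
  ... | inj₂ refl rewrite state-inner i<ℓ | from-end | hub-end = pair≐ ≋-refl ≋-refl

  after : ∀ {i} → i < ℓ → state (suc i) ≐ to i ∷ hub i ∷ []
  after {i} i<ℓ with m<1+n⇒m<n∨m≡n i<ℓ
  ... | inj₁ i<p rewrite state-inner (s≤s i<p) | to-inner i<p | hub-inner i<p = swap≐ ≋-refl ≋-refl
  ... | inj₂ refl rewrite state-end | to-end | hub-end = swap≐ ≋-refl ≋-refl

  wrap : state ℓ ≐ shift (+ 1) (state 0)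
  wrap rewrite state-end | state-inner {0} (s≤s z≤n) = go xp∼1
    where
    -- As `x 0` is -2, the translate of {0, x 0} by 1 is {1, -1}; the sign of `x p` only decides the
    -- order.
    go : ∀ {a} → a ∼ + 1 → a ∷ ℤ.- a ∷ [] ≐ + 1 ∷ ℤ.-[1+ 0 ] ∷ []
    go (inj₁ a≋1)  = pair≐ a≋1 (≋-neg a≋1)
    go (inj₂ a≋-1) = swap≐ a≋-1 (≋-neg a≋-1)

  x≄-x : ∀ {i} → i < ℓ → x i ≄ ℤ.- x i
  x≄-x {i} i<ℓ eq = x≄0 i<ℓ (≋-halve (≋-linear (e (x i)) eq))
    where
    e : ∀ a → a ℤ.+ a ℤ.- (+ 0 ℤ.+ + 0) ≡ a ℤ.- ℤ.- a
    e = solve-∀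

  -x≄0 : ∀ {i} → i < ℓ → ℤ.- x i ≄ + 0
  -x≄0 i<ℓ eq = x≄0 i<ℓ (≋-neg-flip (≋-sym eq) ∙ ≋-refl)

  apart : ∀ {i} → i < ℓ → Apart (to i ∷ from i ∷ hub i ∷ [])
  apart {i} i<ℓ with m<1+n⇒m<n∨m≡n i<ℓ
  ... | inj₁ i<p rewrite to-inner i<p | from-inner i<p | hub-inner i<p =
        ((λ eq → 1+n≢n (x-injective (s≤s i<p) i<ℓ (inj₁ eq))) ∷ x≄0 (s≤s i<p) ∷ [])
      ∷ (x≄0 i<ℓ ∷ []) ∷ [] ∷ []
  ... | inj₂ refl rewrite to-end | from-end | hub-end =
        (-x≄0 i<ℓ ∷ (x≄-x i<ℓ ∘ ≋-sym) ∷ []) ∷ ((x≄0 i<ℓ ∘ ≋-sym) ∷ []) ∷ [] ∷ []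

  orbit : ∀ {i i′} → i < ℓ → i′ < ℓ → ∀ r → state i ≐ shift r (state i′) → i ≡ i′ × r ≋ + 0
  orbit {i} {i′} i<ℓ i′<ℓ r eq rewrite state-inner i<ℓ | state-inner i′<ℓ
    with proj₁ eq (here ≋-refl) | proj₁ eq (there (here ≋-refl))
  ... | here 0≋r | here xi≋r = ⊥-elim (x≄0 i<ℓ (xi≋r ∙ ≋-sym 0≋r))
  ... | here 0≋r | there (here xi≋r+x) =
        x-injective i<ℓ i′<ℓ (inj₁ (xi≋r+x ∙ ≋-+ r≋0 ≋-refl ∙ ≋-reflexive (ℤₚ.+-identityˡ (x i′)))) , r≋0
    where r≋0 = ≋-sym (0≋r ∙ ≋-reflexive (ℤₚ.+-identityʳ r))
  ... | there (here 0≋r+x) | there (here xi≋r+x) = ⊥-elim (x≄0 i<ℓ (xi≋r+x ∙ ≋-sym 0≋r+x))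
  -- The elements are matched crosswise: `r` is both `x i` and `- x i′`, so `i` equals `i′` and
  -- `x i` would be its own negative.
  ... | there (here 0≋r+x) | here xi≋r =
        ⊥-elim (x≄-x i<ℓ (subst (λ m → x i ≋ ℤ.- x m) (sym (x-injective i<ℓ i′<ℓ (inj₂ xi≋-x))) xi≋-x))
    where
    e : ∀ r y → r ℤ.+ + 0 ℤ.- ℤ.- y ≡ r ℤ.+ y ℤ.- + 0
    e = solve-∀
    xi≋-x : x i ≋ ℤ.- x i′
    xi≋-x = xi≋r ∙ ≋-linear (e r (x i′)) (≋-sym 0≋r+x)

  step∼δ : ∀ {i} → i < ℓ → to i ℤ.- from i ∼ δ (π i)
  step∼δ {i} i<ℓ with m<1+n⇒m<n∨m≡n i<ℓ
  ... | inj₁ i<p rewrite to-inner i<p | from-inner i<p | π-inner i<p = x-step i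
  ... | inj₂ refl rewrite to-end | from-end | π-end =
        ∼-trans (inj₂ (≋-reflexive (ℤₚ.+-identityʳ (ℤ.- x p)))) (∼-trans xp∼1 1∼δj)

  block : Block 2
  block = record
    { state = state ; rest = λ i → hub i ∷ [] ; from = from ; to = to
    ; before = before ; after = after ; wrap = wrap
    ; size = λ _ → refl ; apart = apart ; orbit = orbit
    ; step-injective = λ {i} {i′} i<ℓ i′<ℓ eq →
        trans (sym (π⁻¹-π i<ℓ)) (trans (cong π⁻¹ (δ-injective (π-bound i<ℓ) (π-bound i′<ℓ)
          (∼-trans (∼-sym (step∼δ i<ℓ)) (∼-trans eq (step∼δ i′<ℓ))))) (π⁻¹-π i′<ℓ))
    ; step-surjective = λ d d≄0 → let m , m<ℓ , d∼δ = δ-surjective d d≄0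
                                      i , i<ℓ , πi≡m = π-surjective m m<ℓ
        in i , i<ℓ , ∼-trans d∼δ (subst (λ m → δ m ∼ to i ℤ.- from i) πi≡m (∼-sym (step∼δ i<ℓ)))
    }

  1<ℓ : 1 < ℓ
  1<ℓ = s≤s 0<p

  -- The `x i` represent every nonzero class too. For a pair given by residues `a` and `b`, some
  -- `x i` is therefore ±(b - a), and the pair is the translate of {0, x i} by `a` or by `b`.
  cycle-isHamilton : ∀ κ → IsHamilton n 2 (Cycle.cycle 1<ℓ block κ)
  cycle-isHamilton κ A ∣A∣≡2 = contains (∣p∣≡2⇒pair A ∣A∣≡2)
    where
    open Cycle 1<ℓ block κ
    open Realisation κ
    translate∈ : ∀ {i} r → i < ℓ → ⟦ shift r (+ 0 ∷ x i ∷ []) ⟧ ∈ᴸ cycle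
    translate∈ {i} r i<ℓ = subst (_∈ᴸ cycle)
      (trans (vertex-at (residue r) i<ℓ) (trans (⟦⟧-cong (≐-shift-resp (state i) (residue-≋ r)))
        (cong (λ L → ⟦ shift r L ⟧) (state-inner i<ℓ))))
      (∈-applyUpTo⁺ vertex (i+qℓ<nℓ i<ℓ (residue<n r)))
    e₁ : ∀ a b y → b ℤ.- (a ℤ.+ y) ≡ (b ℤ.- a) ℤ.- y
    e₁ = solve-∀
    e₂ : ∀ a b y → (b ℤ.+ y) ℤ.- a ≡ (b ℤ.- a) ℤ.- ℤ.- y
    e₂ = solve-∀
    e₃ : ∀ a b → b ℤ.- a ≡ (b ℤ.- a) ℤ.- + 0
    e₃ = solve-∀
    pair∈ : ∀ a b → (∃ λ i → i < ℓ × b ℤ.- a ∼ double (suc i)) → ⟦ a ∷ b ∷ [] ⟧ ∈ᴸ cycle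
    pair∈ a b (i , i<ℓ , b-a∼) with ∼-trans b-a∼ (∼-sym (x∼double i))
    ... | inj₁ b-a≋x = subst (_∈ᴸ cycle)
            (⟦⟧-cong (pair≐ (≋-reflexive (ℤₚ.+-identityʳ a)) (≋-sym (≋-linear (e₁ a b (x i)) b-a≋x)))) (translate∈ a i<ℓ)
    ... | inj₂ b-a≋-x = subst (_∈ᴸ cycle)
            (⟦⟧-cong (swap≐ (≋-reflexive (ℤₚ.+-identityʳ b)) (≋-linear (e₂ a b (x i)) b-a≋-x))) (translate∈ b i<ℓ)
    contains : (∃₂ λ y z → y ≢ z × A ≡ ⁅ y ⁆ ∪ ⁅ z ⁆) → A ∈ᴸ cycle
    contains (y , z , y≢z , refl) with φ-surjective y | φ-surjective z
    ... | a , refl | b , refl = subst (_∈ᴸ cycle) (cong (⁅ φ a ⁆ ∪_) (∪-identityʳ ⁅ φ b ⁆))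
      (pair∈ a b (double-surjective (b ℤ.- a) λ b-a≋0 → y≢z (φ-cong (≋-sym (≋-linear (e₃ a b) b-a≋0)))))

  turn : ∀ {i} → i < ℓ → ¬ (hub i ℤ.- from i ∼ hub i ℤ.- to i)
  turn {i} i<ℓ eq with m<1+n⇒m<n∨m≡n i<ℓ
  ... | inj₁ i<p rewrite to-inner i<p | from-inner i<p | hub-inner i<p =
        1+n≢n (sym (x-injective i<ℓ (s≤s i<p) (∼-trans (inj₂ (≋-reflexive (e (x i)))) (∼-trans eq
          (inj₂ (≋-reflexive (ℤₚ.+-identityˡ (ℤ.- x (suc i)))))))))
    where
    e : ∀ a → a ≡ ℤ.- (+ 0 ℤ.- a)
    e = solve-∀
  -- The two differences are `x p`, in the class of 2ℓ, and twice `x p`, in the class of 2 because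
  -- `x p` is ±1. These classes differ since ℓ > 1.
  ... | inj₂ refl rewrite to-end | from-end | hub-end =
        <⇒≢ 1<ℓ (sym (double-injective (s≤s z≤n) ≤-refl (s≤s z≤n) (∼-trans (∼-sym (x∼double p))
          (∼-trans (inj₁ (≋-reflexive (sym (ℤₚ.+-identityʳ (x p))))) (∼-trans eq (2x∼2 xp∼1))))))
    where
    2x∼2 : ∀ {a} → a ∼ + 1 → a ℤ.- ℤ.- a ∼ + 2
    2x∼2 (inj₁ a≋1)  = inj₁ (≋-- a≋1 (≋-neg a≋1))
    2x∼2 (inj₂ a≋-1) = inj₂ (≋-- a≋-1 (≋-neg a≋-1))

  cycle-isRainbowHamilton : ∀ κ → IsRainbowHamiltonCycle n 2 (Cycle.cycle 1<ℓ block κ)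
  cycle-isRainbowHamilton κ = Cycle.cycle-isRainbow 1<ℓ block κ , cycle-isHamilton κ

  two-cycles : ∃₂ λ (C D : List (Subset n)) →
    IsRainbowHamiltonCycle n 2 C × IsRainbowHamiltonCycle n 2 D × EdgeDisjoint C D
  two-cycles = Cycle.cycle 1<ℓ block standard , Cycle.cycle 1<ℓ block (mirror standard) ,
    cycle-isRainbowHamilton standard , cycle-isRainbowHamilton (mirror standard) ,
    Mirrored.edge-disjoint ℓ 1<ℓ standard block hub (λ _ → refl) turn

-- Zigzag walks

nth : List ℕ → ℕ → ℕ
nth []       _       = 0
nth (x ∷ xs) zero    = x
nth (x ∷ xs) (suc i) = nth xs i

nth-All : ∀ {P : ℕ → Set} {xs i} → All P xs → i < length xs → P (nth xs i)
nth-All {i = zero}  (px ∷ _)   _         = px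
nth-All {i = suc i} (_  ∷ pxs) (s≤s i<n) = nth-All pxs i<n

nth-AllPairs : ∀ {R : ℕ → ℕ → Set} {xs i j} → AllPairs R xs → i < j → j < length xs → R (nth xs i) (nth xs j)
nth-AllPairs {i = zero}  {suc j} (rx ∷ _)  _         (s≤s j<n) = nth-All rx j<n
nth-AllPairs {i = suc i} {suc j} (_  ∷ rs) (s≤s i<j) (s≤s j<n) = nth-AllPairs rs i<j j<n

∈⇒nth : ∀ {x xs} → x ∈ᴸ xs → ∃ λ i → i < length xs × x ≡ nth xs i
∈⇒nth (here x≡)  = 0 , s≤s z≤n , x≡
∈⇒nth (there x∈) = let i , i<n , x≡ = ∈⇒nth x∈ in suc i , s≤s i<n , x≡

nth-last : ∀ xs y → nth (xs ++ [ y ]) (length xs) ≡ y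
nth-last []       y = refl
nth-last (x ∷ xs) y = nth-last xs y

nth-++ˡ : ∀ xs ys {i} → i < length xs → nth (xs ++ ys) i ≡ nth xs i
nth-++ˡ (x ∷ xs) ys {zero}  _         = refl
nth-++ˡ (x ∷ xs) ys {suc i} (s≤s i<n) = nth-++ˡ xs ys i<n

Decreasing : ℕ → List ℕ → Set
Decreasing b []       = ⊤
Decreasing b (d ∷ ds) = 0 < d × d < b × Decreasing d ds

-- First minus second plus third, and so on. On a decreasing list the subtraction never truncates,
-- by `alternating-head`.
alternating : List ℕ → ℕ
alternating []       = 0
alternating (d ∷ ds) = d ∸ alternating ds

-- Directions are not recorded, since the class of a difference forgets its sign.
data Steps : List ℕ → List ℕ → Set where
  stop : ∀ {p} → Steps (p ∷ []) []
  step : ∀ {p q ps d ds} → q ≡ p + d ⊎ p ≡ q + d → Steps (q ∷ ps) ds → Steps (p ∷ q ∷ ps) (d ∷ ds)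

nth-Steps : ∀ {ps ds i} → Steps ps ds → i < length ds →
  nth ps (suc i) ≡ nth ps i + nth ds i ⊎ nth ps i ≡ nth ps (suc i) + nth ds i
nth-Steps {i = zero}  (step eq _) _         = eq
nth-Steps {i = suc i} (step _ ss) (s≤s i<n) = nth-Steps ss i<n

mutual
  up down : ℕ → List ℕ → List ℕ
  up p []         = p ∷ []
  up p (d ∷ ds)   = p ∷ down (p + d) ds
  down p []       = p ∷ []
  down p (d ∷ ds) = p ∷ up (p ∸ d) ds

mutual
  length-up : ∀ p ds → length (up p ds) ≡ suc (length ds)
  length-up p []       = refl
  length-up p (d ∷ ds) = cong suc (length-down (p + d) ds)

  length-down : ∀ p ds → length (down p ds) ≡ suc (length ds)
  length-down p []       = refl
  length-down p (d ∷ ds) = cong suc (length-up (p ∸ d) ds)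

mutual
  -- Each move is shorter than the one before and goes the opposite way, so the walk never returns
  -- to the position it has just left, and the first move bounds the whole excursion.
  up-range : ∀ {b} p ds → 0 < b → Decreasing b ds → All (λ q → p ≤ q × q < p + b) (up p ds)
  up-range p []       0<b _                   = (≤-refl , m<m+n p 0<b) ∷ []
  up-range p (d ∷ ds) 0<b (0<d , d<b , decr) = (≤-refl , m<m+n p 0<b) ∷
    All.map (λ (q≤ , p<q) → <⇒≤ (+-cancelʳ-< d p _ p<q) , ≤-<-trans q≤ (+-monoʳ-< p d<b))
      (down-range (p + d) ds 0<d (m≤n⇒m≤1+n (m≤n+m d p)) decr)

  -- The lower bound is stated additively; `b ≤ suc p` ensures that `p ∸ d` is a true difference.
  down-range : ∀ {b} p ds → 0 < b → b ≤ suc p → Decreasing b ds → All (λ q → q ≤ p × p < q + b) (down p ds)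
  down-range p []       0<b b≤1+p _                  = (≤-refl , m<m+n p 0<b) ∷ []
  down-range p (d ∷ ds) 0<b b≤1+p (0<d , d<b , decr) = (≤-refl , m<m+n p 0<b) ∷
    All.map (λ {q} (p-d≤q , q<) → <⇒≤ (subst (q <_) (m∸n+n≡m d≤p) q<) ,
        ≤-<-trans (subst (_≤ q + d) (m∸n+n≡m d≤p) (+-monoˡ-≤ d p-d≤q)) (+-monoʳ-< q d<b))
      (up-range (p ∸ d) ds 0<d decr)
    where
    d≤p : d ≤ p
    d≤p = m<1+n⇒m≤n (<-≤-trans d<b b≤1+p)

mutual
  up-unique : ∀ {b} p ds → Decreasing b ds → Unique (up p ds)
  up-unique p []       _                  = [] ∷ []
  up-unique p (d ∷ ds) (0<d , d<b , decr) =
    All.map (λ (_ , p<q) → <⇒≢ (+-cancelʳ-< d p _ p<q)) (down-range (p + d) ds 0<d (m≤n⇒m≤1+n (m≤n+m d p)) decr)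
    ∷ down-unique (p + d) ds (m≤n⇒m≤1+n (m≤n+m d p)) decr

  down-unique : ∀ {b} p ds → b ≤ suc p → Decreasing b ds → Unique (down p ds)
  down-unique p []       _     _                  = [] ∷ []
  down-unique p (d ∷ ds) b≤1+p (0<d , d<b , decr) =
    All.map (λ {q} (_ , q<) → >⇒≢ (subst (q <_) (m∸n+n≡m d≤p) q<)) (up-range (p ∸ d) ds 0<d decr)
    ∷ up-unique (p ∸ d) ds decr
    where
    d≤p : d ≤ p
    d≤p = m<1+n⇒m≤n (<-≤-trans d<b b≤1+p)

alternating-head : ∀ {d} ds → Decreasing d ds → alternating ds ≤ d
alternating-head []       _             = z≤n
alternating-head (e ∷ ds) (_ , e<d , _) = ≤-trans (m∸n≤m e (alternating ds)) (<⇒≤ e<d)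

m∸[n∸o]≡m∸n+o : ∀ m {n o} → n ≤ m → o ≤ n → m ∸ (n ∸ o) ≡ m ∸ n + o
m∸[n∸o]≡m∸n+o m {n} {o} n≤m o≤n = begin
  m ∸ (n ∸ o)                         ≡⟨ cong (_∸ (n ∸ o)) (m∸n+n≡m n≤m) ⟨
  m ∸ n + n ∸ (n ∸ o)                 ≡⟨ +-∸-assoc (m ∸ n) (m∸n≤m n o) ⟩
  m ∸ n + (n ∸ (n ∸ o))               ≡⟨ cong (λ r → m ∸ n + r) (m∸[m∸n]≡n o≤n) ⟩
  m ∸ n + o                           ∎
  where open ≡-Reasoning

module _ (m z : ℕ) where
  mutual
    -- The zigzag ends at its start plus the alternating sum (minus, for `down`), and one further
    -- jump of size `m` upwards reaches `z`.
    up-Steps : ∀ {b} p ds → Decreasing b ds → z ≡ p + alternating ds + m → Steps (up p ds ++ [ z ]) (ds ++ [ m ])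
    up-Steps p [] _ z≡ = step (inj₁ (trans z≡ (cong (_+ m) (+-identityʳ p)))) stop
    up-Steps p (d ∷ []) (0<d , d<b , decr) z≡ =
      step (inj₁ refl) (down-Steps (p + d) [] (m≤n⇒m≤1+n (m≤n+m d p)) decr z≡)
    up-Steps p (d ∷ ds@(_ ∷ _)) (0<d , d<b , decr) z≡ =
      step (inj₁ refl) (down-Steps (p + d) ds (m≤n⇒m≤1+n (m≤n+m d p)) decr
        (trans z≡ (cong (_+ m) (sym (+-∸-assoc p (alternating-head ds decr))))))

    down-Steps : ∀ {b} p ds → b ≤ suc p → Decreasing b ds → z ≡ p ∸ alternating ds + m → Steps (down p ds ++ [ z ]) (ds ++ [ m ])
    down-Steps p [] _ _ z≡ = step (inj₁ z≡) stop
    down-Steps p (d ∷ []) b≤1+p (0<d , d<b , decr) z≡ =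
      step (inj₂ (sym (m∸n+n≡m (m<1+n⇒m≤n (<-≤-trans d<b b≤1+p))))) (up-Steps {d} (p ∸ d) [] decr
        (trans z≡ (cong (_+ m) (sym (+-identityʳ (p ∸ d))))))
    down-Steps p (d ∷ ds@(_ ∷ _)) b≤1+p (0<d , d<b , decr) z≡ =
      step (inj₂ (sym (m∸n+n≡m d≤p))) (up-Steps (p ∸ d) ds decr
        (trans z≡ (cong (_+ m) (m∸[n∸o]≡m∸n+o p d≤p (alternating-head ds decr)))))
      where
      d≤p : d ≤ p
      d≤p = m<1+n⇒m≤n (<-≤-trans d<b b≤1+p)

-- The block of an interval and a walker

module Walker (c′ m b p : ℕ) (ds : List ℕ) where

  c ℓ : ℕ
  c = suc (suc c′)
  ℓ = suc p

  open Modular ℓ hiding (n)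
  n = Modular.n ℓ

  differences : List ℕ
  differences = ds ++ m ∷ c ∷ []

  -- For numbers strictly between 0 and `n` this says that their classes up to sign are distinct.
  Compatible : ℕ → ℕ → Set
  Compatible d e = d ≢ e × d + e ≢ n

  -- By `closing` the jump `m` ends one above the start of the zigzag, and `room` keeps the walker
  -- off the residue -1. The last three conditions say that the step sizes represent each nonzero
  -- class once.
  record Admissible : Set where
    field
      length-ds  : suc (length ds) ≡ p
      decreasing : Decreasing (suc b) ds
      closing    : m ≡ suc (alternating ds)
      room       : suc (suc (c + b)) ≤ ℓ + ℓ
      compatible : AllPairs Compatible differences
      range      : All (λ d → 0 < d × d < n) differences
      covering   : ∀ d → 0 < d → d ≤ ℓ → d ∈ᴸ differences ⊎ ∃ λ e → d + e ≡ n × e ∈ᴸ differences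

  module _ (admissible : Admissible) where
    open Admissible admissible

    W : ℕ
    -- The zigzag descends by at most `b` from its start, so it stays at or above `c`, outside the
    -- interval.
    W = c + b

    walk : List ℕ
    walk = down W ds ++ [ suc W ]

    w : ℕ → ℕ
    w = nth walk

    length-walk : length walk ≡ ℓ
    length-walk = trans (length-++ (down W ds))
      (trans (+-comm (length (down W ds)) 1) (cong suc (trans (length-down W ds) length-ds)))

    length-differences : length differences ≡ ℓ
    length-differences = trans (length-++ ds) (trans (+-comm (length ds) 2) (cong suc length-ds))

    1+b≤1+W : suc b ≤ suc W
    1+b≤1+W = s≤s (m≤n+m b c)

    walk-steps : Steps walk (ds ++ [ m ])
    walk-steps = down-Steps m (suc W) W ds 1+b≤1+W decreasing (sym (begin
      W ∸ alternating ds + m                     ≡⟨ cong (λ r → W ∸ alternating ds + r) closing ⟩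
      W ∸ alternating ds + suc (alternating ds)  ≡⟨ +-suc _ _ ⟩
      suc (W ∸ alternating ds + alternating ds)  ≡⟨ cong suc (m∸n+n≡m alternating≤W) ⟩
      suc W                                      ∎))
      where
      open ≡-Reasoning
      alternating≤W : alternating ds ≤ W
      alternating≤W = ≤-trans (pred-mono-≤ (alternating-< ds decreasing)) (m≤n+m b c)
        where
        alternating-< : ∀ ds → Decreasing (suc b) ds → suc (alternating ds) ≤ suc b
        alternating-< []       _             = s≤s z≤n
        alternating-< (d ∷ ds) (_ , d<b , _) = ≤-<-trans (m∸n≤m d (alternating ds)) d<b

    down-range′ : All (λ q → q ≤ W × W < q + suc b) (down W ds)
    down-range′ = down-range W ds (s≤s z≤n) 1+b≤1+W decreasing

    -- The bound `suc q < n` leaves out n - 1, that is -1, whose absence from every state is used in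
    -- `orbit`.
    walk-range : All (λ q → c ≤ q × suc q < n) walk
    walk-range = All.++⁺
      (All.map (λ {q} (q≤W , W<q+1+b) →
          +-cancelʳ-≤ b c q (m<1+n⇒m≤n (subst (W <_) (+-suc q b) W<q+1+b)) , ≤-trans (s≤s (s≤s q≤W)) (m≤n⇒m≤1+n room))
        down-range′)
      ((m≤n⇒m≤1+n (m≤m+n c b) , s≤s room) ∷ [])

    walk-unique : Unique walk
    walk-unique = AllPairs.++⁺ (down-unique W ds 1+b≤1+W decreasing) ([] ∷ [])
      (All.map (λ (q≤W , _) → <⇒≢ (s≤s q≤W) ∷ []) down-range′)

    w-range : ∀ {i} → i < ℓ → c ≤ w i × suc (w i) < n
    w-range {i} i<ℓ = nth-All walk-range (subst (i <_) (sym length-walk) i<ℓ)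

    c≤w : ∀ {i} → i < ℓ → c ≤ w i
    c≤w = proj₁ ∘ w-range

    w<n : ∀ {i} → i < ℓ → w i < n
    w<n = <-trans (n<1+n _) ∘ proj₂ ∘ w-range

    w-injective : ∀ {i j} → i < ℓ → j < ℓ → w i ≡ w j → i ≡ j
    w-injective {i} {j} i<ℓ j<ℓ eq = ≮⇒≡ (λ i<j → distinct i<j j<ℓ eq) (λ j<i → distinct j<i i<ℓ (sym eq))
      where
      distinct : ∀ {i j} → i < j → j < ℓ → w i ≢ w j
      distinct {j = j} i<j j<ℓ = nth-AllPairs walk-unique i<j (subst (j <_) (sym length-walk) j<ℓ)
      ≮⇒≡ : ¬ i < j → ¬ j < i → i ≡ j
      ≮⇒≡ i≮j j≮i = ≤-antisym (≮⇒≥ j≮i) (≮⇒≥ i≮j)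

    w-0 : w 0 ≡ W
    w-0 = head ds
      where
      head : ∀ ds → nth (down W ds ++ [ suc W ]) 0 ≡ W
      head []       = refl
      head (d ∷ ds) = refl

    w-p : w p ≡ suc W
    w-p = trans (cong w (sym (trans (length-down W ds) length-ds))) (nth-last (down W ds) (suc W))

    c<n : c < n
    c<n = ≤-<-trans (c≤w {0} (s≤s z≤n)) (w<n (s≤s z≤n))

    initial : List ℕ
    initial = applyUpTo suc (suc c′)

    interval : List ℕ
    interval = 0 ∷ initial

    embed : List ℕ → List ℤ
    embed = map (λ i → + i)

    state : ℕ → List ℤ
    state i = pick (i ≟ ℓ) (+ w p ∷ shift (+ 1) (embed interval)) (embed (w i ∷ interval))

    rest : ℕ → List ℤ
    rest i = pick (i ≟ p) (embed (w p ∷ initial)) (embed interval)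

    from to : ℕ → ℤ
    from i = pick (i ≟ p) (+ 0) (+ w i)
    to   i = pick (i ≟ p) (+ c) (+ w (suc i))

    state-end : state ℓ ≡ + w p ∷ shift (+ 1) (embed interval)
    state-end = pick-yes (ℓ ≟ ℓ) refl

    state-inner : ∀ {i} → i < ℓ → state i ≡ embed (w i ∷ interval)
    state-inner {i} i<ℓ = pick-no (i ≟ ℓ) (<⇒≢ i<ℓ)

    rest-end : rest p ≡ embed (w p ∷ initial)
    rest-end = pick-yes (p ≟ p) refl
    from-end : from p ≡ + 0
    from-end = pick-yes (p ≟ p) refl
    to-end : to p ≡ + c
    to-end = pick-yes (p ≟ p) refl

    module _ {i : ℕ} (i<p : i < p) where
      rest-inner : rest i ≡ embed interval
      rest-inner = pick-no (i ≟ p) (<⇒≢ i<p)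
      from-inner : from i ≡ + w i
      from-inner = pick-no (i ≟ p) (<⇒≢ i<p)
      to-inner : to i ≡ + w (suc i)
      to-inner = pick-no (i ≟ p) (<⇒≢ i<p)

    ≐-refl : ∀ {L} → L ≐ L
    ≐-refl = (λ a∈ → a∈) , (λ a∈ → a∈)

    ≐-swap : ∀ {a b L} → a ∷ b ∷ L ≐ b ∷ a ∷ L
    ≐-swap = exchange , exchange
      where
      exchange : ∀ {a b L} → a ∷ b ∷ L ⊑ b ∷ a ∷ L
      exchange (here e)          = there (here e)
      exchange (there (here e))  = here e
      exchange (there (there e)) = there (there e)

    ≐-cons : ∀ {a L M} → L ≐ M → a ∷ L ≐ a ∷ M
    ≐-cons (p , q) = cons p , cons q
      where
      cons : ∀ {a L M} → L ⊑ M → a ∷ L ⊑ a ∷ M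
      cons f (here e)  = here e
      cons f (there e) = there (f e)

    shifted-interval : shift (+ 1) (embed interval) ≐ + c ∷ embed initial
    shifted-interval = subst₂ (λ L M → L ≐ + c ∷ M) (sym shifted) (sym (map-applyUpTo suc (λ i → + i) (suc c′))) (forth , back)
      where
      shifted : shift (+ 1) (embed interval) ≡ applyUpTo (λ i → + suc i) c
      shifted = cong (+ 1 ∷_) (trans
        (cong (shift (+ 1)) (map-applyUpTo suc (λ i → + i) (suc c′)))
        (map-applyUpTo (λ i → + suc i) (λ a → + 1 ℤ.+ a) (suc c′)))
      forth : applyUpTo (λ i → + suc i) c ⊑ + c ∷ applyUpTo (λ i → + suc i) (suc c′)
      forth a∈ with Any.applyUpTo⁻ (λ i → + suc i) a∈
      ... | i , i<c , a≋ with m<1+n⇒m<n∨m≡n i<c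
      ...   | inj₁ i<1+c′ = there (Any.applyUpTo⁺ (λ i → + suc i) a≋ i<1+c′)
      ...   | inj₂ refl   = here a≋
      back : + c ∷ applyUpTo (λ i → + suc i) (suc c′) ⊑ applyUpTo (λ i → + suc i) c
      back (here a≋c) = Any.applyUpTo⁺ (λ i → + suc i) a≋c ≤-refl
      back (there a∈) with Any.applyUpTo⁻ (λ i → + suc i) a∈
      ... | i , i<1+c′ , a≋ = Any.applyUpTo⁺ (λ i → + suc i) a≋ (m<n⇒m<1+n i<1+c′)

    before : ∀ {i} → i < ℓ → state i ≐ from i ∷ rest i
    before {i} i<ℓ with m<1+n⇒m<n∨m≡n i<ℓ
    ... | inj₁ i<p rewrite state-inner i<ℓ | from-inner i<p | rest-inner i<p = ≐-refl
    ... | inj₂ refl rewrite state-inner i<ℓ | from-end | rest-end = ≐-swap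

    after : ∀ {i} → i < ℓ → state (suc i) ≐ to i ∷ rest i
    after {i} i<ℓ with m<1+n⇒m<n∨m≡n i<ℓ
    ... | inj₁ i<p rewrite state-inner (s≤s i<p) | to-inner i<p | rest-inner i<p = ≐-refl
    ... | inj₂ refl rewrite state-end | to-end | rest-end = ≐-trans (≐-cons shifted-interval) ≐-swap

    wrap : state ℓ ≐ shift (+ 1) (state 0)
    wrap rewrite state-end | state-inner {0} (s≤s z≤n) =
      subst (λ v → + v ∷ L ≐ + suc (w 0) ∷ L) (trans (cong suc w-0) (sym w-p)) ≐-refl
      where L = shift (+ 1) (embed interval)

    size : ∀ {i} → i < ℓ → suc (length (rest i)) ≡ suc c
    size {i} i<ℓ with m<1+n⇒m<n∨m≡n i<ℓ
    ... | inj₁ i<p rewrite rest-inner i<p = cong suc (trans (length-map (λ i → + i) interval) (length-applyUpTo (λ i → i) c))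
    ... | inj₂ refl rewrite rest-end = cong (suc ∘ suc) (trans (length-map (λ i → + i) initial) (length-applyUpTo suc (suc c′)))

    apart-embed : ∀ {L} → Unique L → All (_< n) L → Apart (embed L)
    apart-embed []          []          = []
    apart-embed (x∉L ∷ uniq) (x<n ∷ L<n) =
      All.map⁺ (All.zipWith (λ (x≢y , y<n) x≋y → x≢y (≋⇒≡ x<n y<n x≋y)) (x∉L , L<n)) ∷ apart-embed uniq L<n

    interval< : All (_< c) interval
    interval< = All.applyUpTo⁺₁ (λ i → i) c (λ i<c → i<c)

    initial< : All (λ q → 0 < q × q < c) initial
    initial< = All.applyUpTo⁺₁ suc (suc c′) (λ i<1+c′ → s≤s z≤n , s≤s i<1+c′)

    initial-unique : Unique initial
    initial-unique = Unique.applyUpTo⁺₁ suc (suc c′) (λ i<j _ → <⇒≢ i<j ∘ suc-injective)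

    interval-unique : Unique interval
    interval-unique = All.map (<⇒≢ ∘ proj₁) initial< ∷ initial-unique

    outside : ∀ {q L} → c ≤ q → All (_< c) L → All (q ≢_) L
    outside c≤q = All.map (λ r<c → >⇒≢ (<-≤-trans r<c c≤q))

    below-n : ∀ {L} → All (_< c) L → All (_< n) L
    below-n = All.map (λ r<c → <-trans r<c c<n)

    apart : ∀ {i} → i < ℓ → Apart (to i ∷ from i ∷ rest i)
    apart {i} i<ℓ with m<1+n⇒m<n∨m≡n i<ℓ
    ... | inj₁ i<p rewrite to-inner i<p | from-inner i<p | rest-inner i<p =
      apart-embed (((1+n≢n ∘ w-injective (s≤s i<p) i<ℓ) ∷ outside (c≤w (s≤s i<p)) interval<)
                   ∷ outside (c≤w i<ℓ) interval< ∷ interval-unique)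
                  (w<n (s≤s i<p) ∷ w<n i<ℓ ∷ below-n interval<)
    ... | inj₂ refl rewrite to-end | from-end | rest-end =
      apart-embed (((λ ()) ∷ <⇒≢ c<wp ∷ outside ≤-refl initial<c)
                   ∷ (<⇒≢ (<-trans (s≤s z≤n) c<wp) ∷ All.map (<⇒≢ ∘ proj₁) initial<)
                   ∷ outside (<⇒≤ c<wp) initial<c ∷ initial-unique)
                  (c<n ∷ s≤s z≤n ∷ w<n i<ℓ ∷ below-n initial<c)
      where
      initial<c : All (_< c) initial
      initial<c = All.map proj₂ initial<
      c<wp : c < w p
      c<wp = subst (c <_) (sym w-p) (s≤s (m≤m+n c b))

    ∈-state⁻ : ∀ {i a} → a ∈̃ embed (w i ∷ interval) → a ≋ + w i ⊎ ∃ λ f → f < c × a ≋ + f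
    ∈-state⁻ (here a≋w) = inj₁ a≋w
    ∈-state⁻ (there a∈) = inj₂ (Any.applyUpTo⁻ (λ f → f) (Any.map⁻ a∈))

    ∈-state⁺ : ∀ {i a f} → f < c → a ≋ + f → a ∈̃ embed (w i ∷ interval)
    ∈-state⁺ f<c a≋f = there (Any.map⁺ (Any.applyUpTo⁺ (λ f → f) a≋f f<c))

    -1∉state : ∀ {i a} → i < ℓ → a ≋ ℤ.-[1+ 0 ] → ¬ a ∈̃ embed (w i ∷ interval)
    -1∉state {i} {a} i<ℓ a≋-1 a∈ =
      [ impossible (proj₂ (w-range i<ℓ))
      , (λ (f , f<c , a≋f) → impossible (≤-<-trans (≤-trans f<c (c≤w i<ℓ)) (w<n i<ℓ)) a≋f) ]′ (∈-state⁻ {i} a∈)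
      where
      e : ∀ q → + 1 ℤ.+ q ℤ.- + 0 ≡ q ℤ.- ℤ.-[1+ 0 ]
      e = solve-∀
      impossible : ∀ {q} → suc q < n → ¬ a ≋ + q
      impossible {q} 1+q<n a≋q = case ≋⇒≡ 1+q<n (s≤s z≤n) (≋-linear (e (+ q)) (≋-sym a≋q ∙ a≋-1)) of λ ()

    -- The first element f of the interval is the only element of a state with f + 1 inside and f − 1 outside.
    orbit : ∀ {i i′} → i < ℓ → i′ < ℓ → ∀ r → state i ≐ shift r (state i′) → i ≡ i′ × r ≋ + 0
    orbit {i} {i′} i<ℓ i′<ℓ r eq = go (subst₂ (λ L M → L ≐ shift r M) (state-inner i<ℓ) (state-inner i′<ℓ) eq)
      where
      e₁ : ∀ r → + 1 ℤ.+ r ℤ.- r ≡ + 1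
      e₁ = solve-∀
      e₂ : ∀ r f → (r ℤ.- + 1) ℤ.- f ≡ r ℤ.- (+ 1 ℤ.+ f)
      e₂ = solve-∀
      e₃ : ∀ r → (r ℤ.- + 1) ℤ.- r ≡ ℤ.-[1+ 0 ]
      e₃ = solve-∀
      e₄ : ∀ r v → (r ℤ.+ v) ℤ.- r ≡ v
      e₄ = solve-∀
      go : embed (w i ∷ interval) ≐ shift r (embed (w i′ ∷ interval)) → i ≡ i′ × r ≋ + 0
      go (⊑shift , shift⊑) = same-walker r≋0 , r≋0
        where
        no-predecessor : ∀ {f} → suc f < c → ¬ r ≋ + suc f
        no-predecessor {f} 1+f<c r≋1+f = -1∉state i′<ℓ (≋-reflexive (e₃ r))
          (∈̃-shift⁻ {r ℤ.- + 1} r (⊑shift (∈-state⁺ {i} (<-trans (n<1+n f) 1+f<c) (≋-linear (e₂ r (+ f)) r≋1+f))))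
        successor : + 1 ℤ.+ r ∈̃ embed (w i ∷ interval)
        successor = shift⊑ (∈̃-shift⁺ r (∈-state⁺ {i′} {f = 1} (s≤s (s≤s z≤n)) (≋-reflexive (e₁ r))))
        not-walker : ¬ r ≋ + w i
        not-walker r≋w = [ (λ a≋w → 1+n≢n (≋⇒≡ (proj₂ (w-range i<ℓ)) (w<n i<ℓ) (≋-sym (≋-+ (≋-refl {+ 1}) r≋w) ∙ a≋w)))
                         , (λ (f , f<c , a≋f) → <⇒≢ (≤-trans f<c (m≤n⇒m≤1+n (c≤w i<ℓ)))
                             (sym (≋⇒≡ (proj₂ (w-range i<ℓ)) (<-trans f<c c<n) (≋-sym (≋-+ (≋-refl {+ 1}) r≋w) ∙ a≋f)))) ]′
                         (∈-state⁻ {i} successor)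
        r≋0 : r ≋ + 0
        r≋0 = [ ⊥-elim ∘ not-walker
              , (λ { (zero , _ , r≋0) → r≋0 ; (suc f , 1+f<c , r≋1+f) → ⊥-elim (no-predecessor 1+f<c r≋1+f) }) ]′
              (∈-state⁻ {i} (shift⊑ (∈̃-shift⁺ r (∈-state⁺ {i′} {f = 0} (s≤s z≤n) (≋-reflexive (ℤₚ.+-inverseʳ r))))))
        same-walker : r ≋ + 0 → i ≡ i′
        same-walker r≋0 = [ (λ a≋w → sym (w-injective i′<ℓ i<ℓ (≋⇒≡ (w<n i′<ℓ) (w<n i<ℓ) (w≋a ∙ a≋w))))
                          , (λ (f , f<c , a≋f) → ⊥-elim (<⇒≢ (<-≤-trans f<c (c≤w i′<ℓ))
                              (sym (≋⇒≡ (w<n i′<ℓ) (<-trans f<c c<n) (w≋a ∙ a≋f))))) ]′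
                          (∈-state⁻ {i} (shift⊑ (∈̃-shift⁺ r (here (≋-reflexive (e₄ r (+ w i′)))))))
          where
          w≋a : + w i′ ≋ r ℤ.+ + w i′
          w≋a = ≋-+ (≋-sym r≋0) (≋-refl {+ w i′})

    D : ℕ → ℕ
    D = nth differences

    differences≡ : differences ≡ (ds ++ [ m ]) ++ [ c ]
    differences≡ = sym (++-assoc ds [ m ] [ c ])

    length-ds+m : length (ds ++ [ m ]) ≡ p
    length-ds+m = trans (length-++ ds) (trans (+-comm (length ds) 1) length-ds)

    D-inner : ∀ {i} → i < p → D i ≡ nth (ds ++ [ m ]) i
    D-inner {i} i<p = trans (cong (λ L → nth L i) differences≡) (nth-++ˡ (ds ++ [ m ]) [ c ] (subst (i <_) (sym length-ds+m) i<p))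

    D-end : D p ≡ c
    D-end = trans (cong₂ nth differences≡ (sym length-ds+m)) (nth-last (ds ++ [ m ]) c)

    step∼D : ∀ {i} → i < ℓ → to i ℤ.- from i ∼ + D i
    step∼D {i} i<ℓ with m<1+n⇒m<n∨m≡n i<ℓ
    ... | inj₂ refl rewrite to-end | from-end | D-end = inj₁ (≋-reflexive (ℤₚ.+-identityʳ (+ c)))
    ... | inj₁ i<p rewrite to-inner i<p | from-inner i<p | D-inner i<p
      with nth-Steps walk-steps (subst (i <_) (sym length-ds+m) i<p)
    ...   | inj₁ forwards rewrite forwards = inj₁ (≋-reflexive (e (+ w i) (+ nth (ds ++ [ m ]) i)))
      where
      e : ∀ a d → (a ℤ.+ d) ℤ.- a ≡ d
      e = solve-∀
    ...   | inj₂ backwards rewrite backwards = inj₂ (≋-reflexive (e (+ w (suc i)) (+ nth (ds ++ [ m ]) i)))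
      where
      e : ∀ a d → a ℤ.- (a ℤ.+ d) ≡ ℤ.- d
      e = solve-∀

    <length : ∀ {i} → i < ℓ → i < length differences
    <length {i} = subst (i <_) (sym length-differences)

    -- If d ≋ -e, then d and n - e are congruent numbers below `n`, hence equal, and d + e would be
    -- `n`.
    compatible⇒≁ : ∀ {d e} → d < n → 0 < e → e < n → Compatible d e → ¬ (+ d ∼ + e)
    compatible⇒≁ d<n 0<e e<n (d≢e , _) (inj₁ d≋e) = d≢e (≋⇒≡ d<n e<n d≋e)
    compatible⇒≁ {d} {e} d<n 0<e e<n (_ , d+e≢n) (inj₂ d≋-e) with m≤n⇒∃[o]m+o≡n (<⇒≤ e<n)
    ... | o , e+o≡n = d+e≢n (trans (cong (_+ e) (≋⇒≡ d<n o<n (d≋-e ∙ ≋-sym (≋-complement o e o+e≡n)))) o+e≡n)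
      where
      o+e≡n : o + e ≡ n
      o+e≡n = trans (+-comm o e) e+o≡n
      o<n : o < n
      o<n = subst (o <_) o+e≡n (m<m+n o 0<e)

    D-injective : ∀ {i j} → i < ℓ → j < ℓ → + D i ∼ + D j → i ≡ j
    D-injective {i} {j} i<ℓ j<ℓ Di∼Dj =
      ≤-antisym (≮⇒≥ λ j<i → distinct j<i i<ℓ (∼-sym Di∼Dj)) (≮⇒≥ λ i<j → distinct i<j j<ℓ Di∼Dj)
      where
      distinct : ∀ {i j} → i < j → j < ℓ → ¬ (+ D i ∼ + D j)
      distinct i<j j<ℓ = let 0<Dj , Dj<n = nth-All range (<length j<ℓ)
        in compatible⇒≁ (proj₂ (nth-All range (<length (<-trans i<j j<ℓ)))) 0<Dj Dj<n
             (nth-AllPairs compatible i<j (<length j<ℓ))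

    ∈-differences : ∀ {d} → d ∈ᴸ differences → ∃ λ i → i < ℓ × d ≡ D i
    ∈-differences d∈ = let i , i< , d≡ = ∈⇒nth d∈ in i , subst (i <_) length-differences i< , d≡

    -- A residue above `ℓ` is first replaced by its complement to `n`, which is at most `ℓ` and lies
    -- in the same class, so that `covering` applies.
    D-surjective : ∀ d → d ≄ + 0 → ∃ λ i → i < ℓ × d ∼ + D i
    D-surjective d d≄0 = go (residue d) (residue<n d) (≋-sym (residue-≋ d))
      where
      found : ∀ {r a} → a ∼ + r → r ∈ᴸ differences → ∃ λ i → i < ℓ × a ∼ + D i
      found {a = a} a∼r r∈ = let i , i<ℓ , r≡ = ∈-differences r∈ in i , i<ℓ , subst (λ r → a ∼ + r) r≡ a∼r
      small : ∀ {a} r → 0 < r → r ≤ ℓ → a ∼ + r → ∃ λ i → i < ℓ × a ∼ + D i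
      small r 0<r r≤ℓ a∼r =
        [ found a∼r
        , (λ (s , r+s≡n , s∈) → found (∼-trans a∼r (inj₂ (≋-complement r s r+s≡n))) s∈) ]′ (covering r 0<r r≤ℓ)
      go : ∀ r → r < n → d ≋ + r → ∃ λ i → i < ℓ × d ∼ + D i
      go zero      _         d≋0 = ⊥-elim (d≄0 d≋0)
      go r@(suc r′) (s≤s r≤2ℓ) d≋r with r ≤? ℓ | m≤n⇒∃[o]m+o≡n r≤2ℓ
      ... | yes r≤ℓ | _ = small r (s≤s z≤n) r≤ℓ (inj₁ d≋r)
      ... | no  r≰ℓ | o , r+o≡2ℓ = small (suc o) (s≤s z≤n)
              (+-cancelˡ-< r o ℓ (subst (_< r + ℓ) (sym r+o≡2ℓ) (+-monoˡ-< ℓ (≰⇒> r≰ℓ))))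
              (inj₂ (d≋r ∙ ≋-complement r (suc o) (trans (+-suc r o) (cong suc r+o≡2ℓ))))

    block : Block (suc c)
    block = record
      { state = state ; rest = rest ; from = from ; to = to
      ; before = before ; after = after ; wrap = wrap ; size = size ; apart = apart ; orbit = orbit
      ; step-injective  = λ i<ℓ j<ℓ eq →
          D-injective i<ℓ j<ℓ (∼-trans (∼-sym (step∼D i<ℓ)) (∼-trans eq (step∼D j<ℓ)))
      ; step-surjective = λ d d≄0 → let i , i<ℓ , d∼D = D-surjective d d≄0
          in i , i<ℓ , ∼-trans d∼D (∼-sym (step∼D i<ℓ))
      }

    rainbow-cycle : ∃ λ C → IsRainbowCycle n (suc c) C
    rainbow-cycle = _ , Cycle.cycle-isRainbow 1<ℓ block standard
      where
      1<ℓ : 1 < ℓ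
      1<ℓ = s≤s (subst (0 <_) length-ds (s≤s z≤n))

-- Choice of the step sizes

Even Odd : ℕ → Set
Even m = ∃ λ h → m ≡ h + h
Odd  m = ∃ λ h → m ≡ suc (h + h)

m+m≢1+n+n : ∀ m n → m + m ≢ suc (n + n)
m+m≢1+n+n m n eq = even≢odd m n
  (trans (cong (λ r → m + r) (+-identityʳ m)) (trans eq (cong (λ r → suc (n + r)) (sym (+-identityʳ n)))))

Even⇒¬Odd : ∀ {m} → Even m → ¬ Odd m
Even⇒¬Odd (h , refl) (g , eq) = m+m≢1+n+n h g eq

-- a = ⌈ y / 2 ⌉, which is the alternating sum of y, y − 1, …, 1.
data Half (y a : ℕ) : Set where
  exact   : y ≡ a + a → Half y a
  rounded : suc y ≡ a + a → Half y a

-- The alternating sum of y, y − 1, …, 1 with one odd number left out.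
data Skew (y a : ℕ) : Set where
  below : y ≡ suc (a + a) → Skew y a
  above : suc (suc y) ≡ a + a → Skew y a

Half-step : ∀ {y a} → Half y a → Half (suc y) (suc y ∸ a)
Half-step {a = a} (exact refl) = subst (Half _) (sym (m+n∸n≡m (suc a) a)) (rounded (cong suc (sym (+-suc a a))))
Half-step {a = a} (rounded eq) = subst (Half _) (sym (trans (cong (_∸ a) eq) (m+n∸n≡m a a))) (exact eq)

-- The value misses ⌈y / 2⌉ by one, from below for odd `y` and from above for even `y`; subtracting
-- it from y + 1 flips the error.
Skew-step : ∀ {y a} → Skew y a → Skew (suc y) (suc y ∸ a)
Skew-step {a = a} (below refl) = subst (Skew _) (sym (m+n∸n≡m (suc (suc a)) a)) (above (e a))
  where
  e : ∀ a → suc (suc (suc (suc (a + a)))) ≡ (2 + a) + (2 + a)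
  e = ℕ.solve-∀
Skew-step {a = suc a} (above eq) = subst (Skew _)
  (sym (trans (cong (_∸ suc a) (suc-injective eq)) (m+n∸n≡m a (suc a))))
  (below (trans (suc-injective eq) (+-suc a a)))

-- Passing from an odd number to the next even one does not change the rounded half.
Half-skip-even : ∀ {y a} → Even (suc y) → Half y a → Half (suc y) a
Half-skip-even {a = a} even (exact refl) = ⊥-elim (Even⇒¬Odd even (a , refl))
Half-skip-even         even (rounded eq) = exact eq

Half-skip-odd : ∀ {y a} → Odd (suc y) → Half y a → Skew (suc y) a
Half-skip-odd         odd (exact eq)   = below (cong suc eq)
Half-skip-odd {a = a} odd (rounded eq) = ⊥-elim (Even⇒¬Odd (a , eq) odd)

-- Leaving out a second odd number repairs the error: `y` is even, and one more than y / 2 is the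
-- rounded half of y + 1.
Skew-skip-odd : ∀ {y a} → Odd (suc y) → Skew y a → Half (suc y) a
Skew-skip-odd {a = a} odd (below refl) = ⊥-elim (Even⇒¬Odd (suc a , cong suc (sym (+-suc a a))) odd)
Skew-skip-odd         odd (above eq)   = rounded eq

Half-unique : ∀ {y a b} → Half y a → Half y b → a ≡ b
Half-unique (exact eq)   (exact eq′)   = m+m-injective (trans (sym eq) eq′)
Half-unique (rounded eq) (rounded eq′) = m+m-injective (trans (sym eq) eq′)
Half-unique {a = a} {b} (exact refl) (rounded eq) = ⊥-elim (m+m≢1+n+n b a (sym eq))
Half-unique {a = a} {b} (rounded eq) (exact refl) = ⊥-elim (m+m≢1+n+n a b (sym eq))

Half-≤ : ∀ {y a} → Half y a → a ≤ y
Half-≤ {a = a}     (exact refl) = m≤m+n a a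
Half-≤ {a = suc a} (rounded eq) = subst (suc a ≤_) (sym (suc-injective eq)) (m≤n+m (suc a) a)

Half-lower : ∀ {y a} → Half y a → y ≤ a + a
Half-lower (exact eq)   = ≤-reflexive eq
Half-lower (rounded eq) = <⇒≤ (≤-reflexive eq)

Half-upper : ∀ {y a} → Half y a → a + a ≤ suc y
Half-upper (exact eq)   = m≤n⇒m≤1+n (≤-reflexive (sym eq))
Half-upper (rounded eq) = ≤-reflexive (sym eq)

Half-+2 : ∀ {y a} → Half y a → Half (suc (suc y)) (suc a)
Half-+2 {a = a} (exact refl) = exact (cong suc (sym (+-suc a a)))
Half-+2 {a = a} (rounded eq) = rounded (trans (cong (suc ∘ suc) eq) (cong suc (sym (+-suc a a))))

∃-Half : ∀ y → ∃ (Half y)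
∃-Half y with half y
... | h , inj₁ eq = h , exact eq
... | h , inj₂ eq = suc h , rounded (trans (cong suc eq) (cong suc (sym (+-suc h h))))

SameParity : ℕ → ℕ → Set
SameParity a b = (Even a × Even b) ⊎ (Odd a × Odd b)

decreasing-weaken : ∀ {b b′} ds → b ≤ b′ → Decreasing b ds → Decreasing b′ ds
decreasing-weaken []       _    _                   = tt
decreasing-weaken (d ∷ ds) b≤b′ (0<d , d<b , decr) = 0<d , <-≤-trans d<b b≤b′ , decr

SameParity-sym : ∀ {a b} → SameParity a b → SameParity b a
SameParity-sym (inj₁ (p , q)) = inj₁ (q , p)
SameParity-sym (inj₂ (p , q)) = inj₂ (q , p)

module Descent (u v : ℕ) where

  skip? : ∀ d → Dec (d ≡ u ⊎ d ≡ v)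
  skip? d = (d ≟ u) ⊎-dec (d ≟ v)

  descent : ℕ → List ℕ
  descent zero    = []
  descent (suc y) = pick (skip? (suc y)) (descent y) (suc y ∷ descent y)

  descent-decreasing : ∀ y → Decreasing (suc y) (descent y)
  descent-decreasing zero = tt
  descent-decreasing (suc y) with skip? (suc y)
  ... | yes _ = decreasing-weaken (descent y) (n≤1+n _) (descent-decreasing y)
  ... | no  _ = s≤s z≤n , ≤-refl , descent-decreasing y

  descent-avoids : ∀ y → All (λ d → 0 < d × d ≤ y × d ≢ u × d ≢ v) (descent y)
  descent-avoids zero = []
  descent-avoids (suc y) with skip? (suc y)
  ... | yes _ = All.map (λ (0<d , d≤y , ne) → 0<d , m≤n⇒m≤1+n d≤y , ne) (descent-avoids y)
  ... | no  ¬skip = (s≤s z≤n , ≤-refl , ¬skip ∘ inj₁ , ¬skip ∘ inj₂)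
    ∷ All.map (λ (0<d , d≤y , ne) → 0<d , m≤n⇒m≤1+n d≤y , ne) (descent-avoids y)

  descent-covers : ∀ y d → 0 < d → d ≤ y → d ≡ u ⊎ d ≡ v ⊎ d ∈ᴸ descent y
  descent-covers zero    d 0<d d≤0 = ⊥-elim (<⇒≱ 0<d d≤0)
  descent-covers (suc y) d 0<d d≤1+y with skip? (suc y) | m≤n⇒m<n∨m≡n d≤1+y
  ... | yes (inj₁ ≡u) | inj₂ refl = inj₁ ≡u
  ... | yes (inj₂ ≡v) | inj₂ refl = inj₂ (inj₁ ≡v)
  ... | yes _ | inj₁ (s≤s d≤y) = descent-covers y d 0<d d≤y
  ... | no  _ | inj₂ refl = inj₂ (inj₂ (here refl))
  ... | no  _ | inj₁ (s≤s d≤y) with descent-covers y d 0<d d≤y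
  ...   | inj₁ ≡u        = inj₁ ≡u
  ...   | inj₂ (inj₁ ≡v) = inj₂ (inj₁ ≡v)
  ...   | inj₂ (inj₂ d∈) = inj₂ (inj₂ (there d∈))

  -- `K` is the invariant of the alternating sum between the two omitted numbers: `Half` itself if
  -- they are even, `Skew` if they are odd.
  module Track (u<v : u < v) (K : ℕ → ℕ → Set)
    (K-step : ∀ {y a} → K y a → K (suc y) (suc y ∸ a))
    (enter : ∀ {y a} → suc y ≡ u → Half y a → K (suc y) a)
    (leave : ∀ {y a} → suc y ≡ v → K y a → Half (suc y) a) where

    -- The phases record how many of `u` and `v` have been omitted, and so by how much the length
    -- `l` lags behind `y`.
    data Phase (y l a : ℕ) : Set where
      early  : y < u → l ≡ y → Half y a → Phase y l a
      middle : u ≤ y → y < v → suc l ≡ y → K y a → Phase y l a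
      late   : v ≤ y → suc (suc l) ≡ y → Half y a → Phase y l a

    phase : 0 < u → ∀ y → Phase y (length (descent y)) (alternating (descent y))
    phase 0<u zero = early 0<u refl (exact refl)
    phase 0<u (suc y) with skip? (suc y) | phase 0<u y
    ... | yes (inj₁ ≡u) | early _ l≡y h = middle (≤-reflexive (sym ≡u)) (subst (_< v) (sym ≡u) u<v) (cong suc l≡y) (enter ≡u h)
    ... | yes (inj₁ ≡u) | middle u≤y _ _ _ = ⊥-elim (<⇒≱ (≤-reflexive ≡u) u≤y)
    ... | yes (inj₁ ≡u) | late v≤y _ _ = ⊥-elim (<⇒≱ (≤-reflexive ≡u) (≤-trans (<⇒≤ u<v) v≤y))
    ... | yes (inj₂ ≡v) | early y<u _ _ = ⊥-elim (<⇒≱ u<v (subst (_≤ u) ≡v y<u))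
    ... | yes (inj₂ ≡v) | middle _ _ l≡y k = late (≤-reflexive (sym ≡v)) (cong suc l≡y) (leave ≡v k)
    ... | yes (inj₂ ≡v) | late v≤y _ _ = ⊥-elim (<⇒≱ (≤-reflexive ≡v) v≤y)
    ... | no ¬skip | early y<u l≡y h = early (≤∧≢⇒< y<u (¬skip ∘ inj₁)) (cong suc l≡y) (Half-step h)
    ... | no ¬skip | middle u≤y y<v l≡y k = middle (m≤n⇒m≤1+n u≤y) (≤∧≢⇒< y<v (¬skip ∘ inj₂)) (cong suc l≡y) (K-step k)
    ... | no ¬skip | late v≤y l≡y h = late (m≤n⇒m≤1+n v≤y) (cong suc l≡y) (Half-step h)

    final : 0 < u → ∀ {y} → v ≤ y → suc (suc (length (descent y))) ≡ y × Half y (alternating (descent y))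
    final 0<u {y} v≤y with phase 0<u y
    ... | early y<u _ _    = ⊥-elim (<⇒≱ y<u (≤-trans (<⇒≤ u<v) v≤y))
    ... | middle _ y<v _ _ = ⊥-elim (<⇒≱ y<v v≤y)
    ... | late _ l≡y h     = l≡y , h

  -- Omitting two numbers of equal parity leaves the alternating sum at ⌈y / 2⌉, whichever they are.
  -- This is why `m` is given the parity of `c`: its value can then be fixed before the list is
  -- built.
  descent-final : SameParity u v → u < v → 0 < u → ∀ {y} → v ≤ y →
    suc (suc (length (descent y))) ≡ y × Half y (alternating (descent y))
  descent-final (inj₁ (even-u , even-v)) u<v = Track.final u<v Half Half-step
    (λ ≡u → Half-skip-even (subst Even (sym ≡u) even-u)) (λ ≡v → Half-skip-even (subst Even (sym ≡v) even-v))
  descent-final (inj₂ (odd-u , odd-v)) u<v = Track.final u<v Skew Skew-step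
    (λ ≡u → Half-skip-odd (subst Odd (sym ≡u) odd-u)) (λ ≡v → Skew-skip-odd (subst Odd (sym ≡v) odd-v))

record Descending (c m y : ℕ) : Set where
  field
    list        : List ℕ
    decreasing  : Decreasing (suc y) list
    avoids      : All (λ d → 0 < d × d ≤ y × d ≢ c × d ≢ m) list
    covers      : ∀ d → 0 < d → d ≤ y → d ≡ c ⊎ d ≡ m ⊎ d ∈ᴸ list
    length-list : suc (suc (length list)) ≡ y
    halved      : Half y (alternating list)

Descending-swap : ∀ {c m y} → Descending c m y → Descending m c y
Descending-swap D = record
  { list = list ; decreasing = decreasing ; length-list = length-list ; halved = halved
  ; avoids = All.map (λ (p , q , ≢c , ≢m) → p , q , ≢m , ≢c) avoids
  ; covers = λ d 0<d d≤y → [ inj₂ ∘ inj₁ , [ inj₁ , inj₂ ∘ inj₂ ]′ ]′ (covers d 0<d d≤y)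
  }
  where open Descending D

descending : ∀ {c m y} → SameParity c m → c ≢ m → 0 < c → 0 < m → c ≤ y → m ≤ y → Descending c m y
descending {c} {m} {y} par c≢m 0<c 0<m c≤y m≤y with <-cmp c m
... | tri≈ _ c≡m _ = ⊥-elim (c≢m c≡m)
... | tri< c<m _ _ = let l , h = descent-final par c<m 0<c m≤y in record
  { list = descent y ; decreasing = descent-decreasing y ; avoids = descent-avoids y
  ; covers = descent-covers y ; length-list = l ; halved = h }
  where open Descent c m
... | tri> _ _ m<c = let l , h = descent-final (SameParity-sym par) m<c 0<m c≤y in Descending-swap record
  { list = descent y ; decreasing = descent-decreasing y ; avoids = descent-avoids y
  ; covers = descent-covers y ; length-list = l ; halved = h }
  where open Descent m c

Even-+2 : ∀ {a} → Even a → Even (suc (suc a))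
Even-+2 (h , refl) = suc h , cong suc (sym (+-suc h h))

Odd-+2 : ∀ {a} → Odd a → Odd (suc (suc a))
Odd-+2 (h , refl) = suc h , cong (suc ∘ suc) (sym (+-suc h h))

SameParity-+2 : ∀ {a b} → SameParity a b → SameParity a (suc (suc b))
SameParity-+2 (inj₁ (p , q)) = inj₁ (p , Even-+2 q)
SameParity-+2 (inj₂ (p , q)) = inj₂ (p , Odd-+2 q)

same-parity : ∀ a b → SameParity a b ⊎ SameParity a (suc b)
same-parity a b with half a | half b
... | g , inj₁ p | h , inj₁ q = inj₁ (inj₁ ((g , p) , (h , q)))
... | g , inj₁ p | h , inj₂ q = inj₂ (inj₁ ((g , p) , (suc h , trans (cong suc q) (cong suc (sym (+-suc h h))))))
... | g , inj₂ p | h , inj₁ q = inj₂ (inj₂ ((g , p) , (h , cong suc q)))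
... | g , inj₂ p | h , inj₂ q = inj₁ (inj₂ ((g , p) , (h , q)))

-- The classes of 1, ..., y are represented by these numbers themselves, those of y + 1, ..., ℓ by
-- the entries of `top`. An entry strictly between `y` and n - y shares its class with no number up
-- to `y`.
module Prefixed (c′ m b p y : ℕ) (top : List ℕ) (D : Descending (suc (suc c′)) m y) where
  open Descending D
  open Walker c′ m b p (top ++ list) using (c; ℓ; n; Compatible; Admissible; differences)

  admissible :
    length top + y ≡ ℓ → Decreasing (suc b) (top ++ list) → m ≡ suc (alternating (top ++ list)) →
    suc (suc (c + b)) ≤ ℓ + ℓ → c ≢ m → 0 < m → c ≤ y → m ≤ y →
    AllPairs Compatible top → All (λ t → y < t × t + y < n) top →
    (∀ d → y < d → d ≤ ℓ → d ∈ᴸ top ⊎ ∃ λ e → d + e ≡ n × e ∈ᴸ top) → Admissible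
  admissible len decr closing room c≢m 0<m c≤y m≤y top-compatible top-range top-covers = record
    { length-ds  = suc-injective (trans (cong (suc ∘ suc) (length-++ top))
        (trans (e (length top) (length list)) (trans (cong (λ r → length top + r) length-list) len)))
    ; decreasing = decr
    ; closing    = closing
    ; room       = room
    ; compatible = AllPairs.++⁺
        (AllPairs.++⁺ top-compatible (list-compatible list decreasing avoids)
          (All.map (λ t-range → All.map (λ (_ , d≤y , _) → high t-range d≤y) avoids) top-range))
        (((low m≤y c≤y (c≢m ∘ sym)) ∷ []) ∷ [] ∷ [])
        (All.++⁺ (All.map (λ t-range → high t-range m≤y ∷ high t-range c≤y ∷ []) top-range)
          (All.map (λ (_ , d≤y , d≢c , d≢m) → low d≤y m≤y d≢m ∷ low d≤y c≤y d≢c ∷ []) avoids))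
    ; range      = All.++⁺ (All.++⁺
        (All.map (λ {t} (y<t , t+y<n) → ≤-<-trans z≤n y<t , ≤-<-trans (m≤m+n t y) t+y<n) top-range)
        (All.map (λ (0<d , d≤y , _) → 0<d , y<n d≤y) avoids))
        ((0<m , y<n m≤y) ∷ (s≤s z≤n , y<n c≤y) ∷ [])
    ; covering   = λ d 0<d d≤ℓ → covering d 0<d d≤ℓ
    }
    where
    e : ∀ t l → suc (suc (t + l)) ≡ t + suc (suc l)
    e = ℕ.solve-∀
    y≤ℓ : y ≤ ℓ
    y≤ℓ = subst (y ≤_) len (m≤n+m y (length top))
    y<n : ∀ {d} → d ≤ y → d < n
    y<n d≤y = s≤s (≤-trans d≤y (≤-trans y≤ℓ (m≤m+n ℓ ℓ)))
    low : ∀ {d e} → d ≤ y → e ≤ y → d ≢ e → Compatible d e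
    low d≤y e≤y d≢e = d≢e , <⇒≢ (s≤s (+-mono-≤ (≤-trans d≤y y≤ℓ) (≤-trans e≤y y≤ℓ)))
    high : ∀ {t d} → y < t × t + y < n → d ≤ y → Compatible t d
    high {t} (y<t , t+y<n) d≤y = >⇒≢ (≤-<-trans d≤y y<t) , <⇒≢ (≤-<-trans (+-monoʳ-≤ t d≤y) t+y<n)
    bounded : ∀ {b} ds → Decreasing b ds → All (_< b) ds
    bounded []       _                   = []
    bounded (d ∷ ds) (_ , d<b , decr) = d<b ∷ All.map (λ e<d → <-trans e<d d<b) (bounded ds decr)
    list-compatible : ∀ {b} {P : ℕ → Set} ds → Decreasing b ds → All (λ d → 0 < d × d ≤ y × P d) ds → AllPairs Compatible ds
    list-compatible []       _              _                       = []
    list-compatible (d ∷ ds) (_ , _ , decr) ((_ , d≤y , _) ∷ rest) =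
      All.zipWith (λ (e<d , _ , e≤y , _) → low d≤y e≤y (>⇒≢ e<d)) (bounded ds decr , rest) ∷ list-compatible ds decr rest
    in-top : ∀ {t} → t ∈ᴸ top → t ∈ᴸ differences
    in-top = ∈-++⁺ˡ ∘ ∈-++⁺ˡ
    covering : ∀ d → 0 < d → d ≤ ℓ → d ∈ᴸ differences ⊎ ∃ λ e → d + e ≡ n × e ∈ᴸ differences
    covering d 0<d d≤ℓ with d ≤? y
    ... | no d≰y = [ inj₁ ∘ in-top , (λ (e , d+e≡n , e∈) → inj₂ (e , d+e≡n , in-top e∈)) ]′ (top-covers d (≰⇒> d≰y) d≤ℓ)
    ... | yes d≤y with covers d 0<d d≤y
    ...   | inj₁ d≡c        = inj₁ (∈-++⁺ʳ (top ++ list) (there (here d≡c)))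
    ...   | inj₂ (inj₁ d≡m) = inj₁ (∈-++⁺ʳ (top ++ list) (here d≡m))
    ...   | inj₂ (inj₂ d∈)  = inj₁ (∈-++⁺ˡ (∈-++⁺ʳ top d∈))

RainbowCycle : ℕ → ℕ → Set
RainbowCycle ℓ k = ∃ λ C → IsRainbowCycle (suc (ℓ + ℓ)) k C

module Choices (c′ A : ℕ) where

  c : ℕ
  c = suc (suc c′)

  -- The numbers 1, ..., ℓ represent the classes, so the alternating sum is A = ⌈ℓ / 2⌉ and `m` is 1
  -- + A.
  plain : ∀ {p} (let ℓ = suc p) → Descending c (1 + A) ℓ → Half ℓ A →
    c ≢ 1 + A → c + 3 ≤ ℓ → 1 + A ≤ ℓ → RainbowCycle ℓ (suc c)
  plain {p} D half-A c≢m c+3≤ℓ m≤ℓ = Walker.rainbow-cycle c′ (1 + A) ℓ p list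
    (Prefixed.admissible c′ (1 + A) ℓ p ℓ [] D refl decreasing (cong suc (Half-unique half-A halved))
      (subst (_≤ ℓ + ℓ) (e c ℓ) (+-monoˡ-≤ ℓ (≤-trans (+-monoʳ-≤ c (n≤1+n 2)) c+3≤ℓ)))
      c≢m (s≤s z≤n) (≤-trans (m≤m+n c 3) c+3≤ℓ) m≤ℓ [] [] (λ d ℓ<d d≤ℓ → ⊥-elim (<⇒≱ ℓ<d d≤ℓ)))
    where
    ℓ = suc p
    open Descending D
    e : ∀ c l → c + 2 + l ≡ suc (suc (c + l))
    e = ℕ.solve-∀

  -- Using ℓ + 1 for the class of ℓ raises the alternating sum, hence m, by one.
  raised : ∀ {y} (let ℓ = suc y) → Descending c (2 + A) y → Half ℓ A →
    c ≢ 2 + A → c + 3 ≤ ℓ → 2 + A ≤ y → RainbowCycle ℓ (suc c)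
  raised {y} D half-A c≢m c+3≤ℓ m≤y = Walker.rainbow-cycle c′ (2 + A) (2 + y) y ((2 + y) ∷ list)
    (Prefixed.admissible c′ (2 + A) (2 + y) y y [ 2 + y ] D refl
      (s≤s z≤n , ≤-refl , decreasing-weaken list (n≤1+n (suc y)) decreasing)
      (cong suc (trans (cong suc (Half-unique half-A (Half-step {a = alternating list} halved)))
        (sym (+-∸-assoc 1 {o = alternating list} (m≤n⇒m≤1+n (Half-≤ halved))))))
      (subst (_≤ ℓ + ℓ) (e₁ c y) (+-monoˡ-≤ ℓ c+3≤ℓ))
      c≢m (s≤s z≤n) (m<1+n⇒m≤n (<-≤-trans (m<m+n c (s≤s z≤n)) c+3≤ℓ)) m≤y
      ([] ∷ []) ((s≤s (n≤1+n y) , ≤-reflexive (cong (suc ∘ suc) (sym (+-suc y y)))) ∷ [])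
      (λ d y<d d≤ℓ → inj₂ (2 + y , trans (cong (_+ (2 + y)) (≤-antisym d≤ℓ y<d)) (e₂ y) , here refl)))
    where
    ℓ = suc y
    open Descending D
    e₁ : ∀ c y → c + 3 + suc y ≡ suc (suc (c + (2 + y)))
    e₁ = ℕ.solve-∀
    e₂ : ∀ y → suc y + (2 + y) ≡ suc (suc y + suc y)
    e₂ = ℕ.solve-∀

  module _ {y : ℕ} (half-A : Half (3 + y) A) where

    ℓ : ℕ
    ℓ = 3 + y

    -- This evaluates the part of the alternating sum that begins at ℓ - 1 in `wide`. Subtracting
    -- from y + 1 gives the rounded half of y + 1, and one more is the rounded half of y + 3.
    two-up : ∀ {a} → Half y a → 2 + y ∸ a ≡ A
    two-up {a} half-a = trans (+-∸-assoc 1 (m≤n⇒m≤1+n (Half-≤ half-a)))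
      (Half-unique (Half-+2 (Half-step {a = a} half-a)) half-A)

    -- If m would coincide with c, the classes of ℓ, ℓ − 1, ℓ − 2 are represented by
    -- ℓ + 3, r, ℓ − 1 instead, which raises m by another two.
    wide : ∀ r → 3 + y ≤ r → r ≤ 4 + y → 3 + y + r ≡ suc (ℓ + ℓ) ⊎ 3 + y ≡ r →
      Descending c (2 + c) y → 2 + c ≡ suc (6 + y ∸ (r ∸ A)) → 2 + c ≤ y → RainbowCycle ℓ (suc c)
    wide r 3+y≤r r≤4+y covers-ℓ D m≡ m≤y =
      Walker.rainbow-cycle c′ (2 + c) (6 + y) (2 + y) (6 + y ∷ r ∷ 2 + y ∷ list)
        (Prefixed.admissible c′ (2 + c) (6 + y) (2 + y) y (6 + y ∷ r ∷ 2 + y ∷ []) D refl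
          (s≤s z≤n , ≤-refl , ≤-<-trans z≤n 3+y≤r , r<6+y , s≤s z≤n , 3+y≤r ,
            decreasing-weaken list (n≤1+n (suc y)) decreasing)
          (trans m≡ (cong (λ a → suc (6 + y ∸ (r ∸ a))) (sym (two-up halved))))
          (subst₂ _≤_ (e₁ c y) (e₂ y) (+-monoˡ-≤ (6 + y) m≤y))
          (<⇒≢ (m≤n⇒m≤1+n ≤-refl)) (s≤s z≤n) (≤-trans (m≤n+m c 2) m≤y) m≤y
          (((>⇒≢ r<6+y , >⇒≢ (≤-trans (≤-trans (n≤1+n _) (≤-reflexive (e₃ y))) (+-monoʳ-≤ (6 + y) 3+y≤r)))
              ∷ (>⇒≢ (<-trans 3+y≤r r<6+y) , >⇒≢ (≤-reflexive (e₄ y))) ∷ [])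
            ∷ ((>⇒≢ 3+y≤r , <⇒≢ (≤-trans (s≤s (+-monoˡ-≤ (2 + y) r≤4+y)) (≤-reflexive (e₅ y)))) ∷ [])
            ∷ [] ∷ [])
          ((m≤n+m (suc y) 5 , ≤-reflexive (e₆ y))
            ∷ (≤-trans (m≤n+m (suc y) 2) 3+y≤r ,
                ≤-trans (s≤s (+-monoˡ-≤ y r≤4+y)) (≤-trans (m≤n+m (5 + y + y) 2) (≤-reflexive (e₆ y))))
            ∷ (s≤s (n≤1+n y) , ≤-trans (m≤n+m (3 + y + y) 4) (≤-reflexive (e₆ y))) ∷ [])
          top-covers)
      where
      open Descending D
      r<6+y : r < 6 + y
      r<6+y = s≤s (m≤n⇒m≤1+n r≤4+y)
      e₁ : ∀ c y → 2 + c + (6 + y) ≡ suc (suc (c + (6 + y)))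
      e₁ = ℕ.solve-∀
      e₂ : ∀ y → y + (6 + y) ≡ (3 + y) + (3 + y)
      e₂ = ℕ.solve-∀
      e₃ : ∀ y → 3 + ((3 + y) + (3 + y)) ≡ (6 + y) + (3 + y)
      e₃ = ℕ.solve-∀
      e₄ : ∀ y → 2 + ((3 + y) + (3 + y)) ≡ (6 + y) + (2 + y)
      e₄ = ℕ.solve-∀
      e₅ : ∀ y → suc ((4 + y) + (2 + y)) ≡ suc ((3 + y) + (3 + y))
      e₅ = ℕ.solve-∀
      e₆ : ∀ y → suc ((6 + y) + y) ≡ suc ((3 + y) + (3 + y))
      e₆ = ℕ.solve-∀
      e₇ : ∀ y → (1 + y) + (6 + y) ≡ suc ((3 + y) + (3 + y))
      e₇ = ℕ.solve-∀
      top-covers : ∀ d → y < d → d ≤ 3 + y → d ∈ᴸ 6 + y ∷ r ∷ 2 + y ∷ [] ⊎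
        ∃ λ e → d + e ≡ suc (ℓ + ℓ) × e ∈ᴸ 6 + y ∷ r ∷ 2 + y ∷ []
      top-covers d y<d d≤3+y with m≤n⇒m<n∨m≡n y<d
      ... | inj₂ refl = inj₂ (6 + y , e₇ y , here refl)
      ... | inj₁ 1+y<d with m≤n⇒m<n∨m≡n 1+y<d
      ...   | inj₂ refl  = inj₁ (there (there (here refl)))
      ...   | inj₁ 2+y<d with ≤-antisym d≤3+y 2+y<d
      ...     | refl = [ (λ eq → inj₂ (r , eq , there (here refl))) , (λ eq → inj₁ (there (here eq))) ]′ covers-ℓ

module _ {ℓ c : ℕ} (2≤c : 2 ≤ c) (3c+3≤2ℓ : c + c + c + 3 ≤ ℓ + ℓ) where

  -- Otherwise ℓ ≤ c + 2, and 3c + 3 ≤ 2c + 4 contradicts c ≥ 2.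
  c+3≤ℓ : c + 3 ≤ ℓ
  c+3≤ℓ = ≮⇒≥ λ ℓ<c+3 → <⇒≱ 2≤c (+-cancelˡ-≤ (c + c + 3) c 1
    (subst₂ _≤_ (e₁ c) (e₂ c) (≤-trans 3c+3≤2ℓ (+-mono-≤ (ℓ≤c+2 ℓ<c+3) (ℓ≤c+2 ℓ<c+3)))))
    where
    ℓ≤c+2 : ℓ < c + 3 → ℓ ≤ c + 2
    ℓ≤c+2 ℓ<c+3 = m<1+n⇒m≤n (subst (ℓ <_) (+-suc c 2) ℓ<c+3)
    e₁ : ∀ c → c + c + c + 3 ≡ c + c + 3 + c
    e₁ = ℕ.solve-∀
    e₂ : ∀ c → c + 2 + (c + 2) ≡ c + c + 3 + 1
    e₂ = ℕ.solve-∀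

  -- Provides the room for `wide`. Together with 3c + 3 ≤ 2ℓ the premise gives c ≥ 7, whereas ℓ ≤ c
  -- + 4 would give c ≤ 5.
  c+5≤ℓ : 2 + ℓ ≤ c + c → c + 5 ≤ ℓ
  c+5≤ℓ 2+ℓ≤2c = ≮⇒≥ λ ℓ<c+5 → <⇒≱ (≤-trans (n≤1+n 6) 7≤c) (c≤5 (m<1+n⇒m≤n (subst (ℓ <_) (+-suc c 4) ℓ<c+5)))
    where
    e₁ : ∀ c → 4 + (c + c + c + 3) ≡ c + c + c + 7
    e₁ = ℕ.solve-∀
    e₂ : ∀ l → 4 + (l + l) ≡ 2 + l + (2 + l)
    e₂ = ℕ.solve-∀
    e₃ : ∀ c → c + c + (c + c) ≡ c + c + c + c
    e₃ = ℕ.solve-∀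
    e₄ : ∀ c → c + c + c + 3 ≡ c + c + 3 + c
    e₄ = ℕ.solve-∀
    e₅ : ∀ c → c + 4 + (c + 4) ≡ c + c + 3 + 5
    e₅ = ℕ.solve-∀
    7≤c : 7 ≤ c
    7≤c = +-cancelˡ-≤ (c + c + c) 7 c (subst₂ _≤_ (e₁ c) (e₃ c)
      (≤-trans (+-monoʳ-≤ 4 3c+3≤2ℓ) (≤-trans (≤-reflexive (e₂ ℓ)) (+-mono-≤ 2+ℓ≤2c 2+ℓ≤2c))))
    c≤5 : ℓ ≤ c + 4 → c ≤ 5
    c≤5 ℓ≤c+4 = +-cancelˡ-≤ (c + c + 3) c 5 (subst₂ _≤_ (e₄ c) (e₅ c) (≤-trans 3c+3≤2ℓ (+-mono-≤ ℓ≤c+4 ℓ≤c+4)))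

  -- The only obstruction is ℓ = 5, c = 2, A = 3, where the parities differ.
  3+A≤ℓ : ∀ A → A + A ≤ suc ℓ → SameParity c (2 + A) → 3 + A ≤ ℓ
  3+A≤ℓ A 2A≤1+ℓ par = ≮⇒≥ λ ℓ<3+A → small A (A≤3 (m<1+n⇒m≤n ℓ<3+A)) (m<1+n⇒m≤n ℓ<3+A) par
    where
    A≤3 : ℓ ≤ 2 + A → A ≤ 3
    A≤3 ℓ≤2+A = +-cancelˡ-≤ A A 3 (≤-trans 2A≤1+ℓ (≤-trans (s≤s ℓ≤2+A) (≤-reflexive (+-comm 3 A))))
    too-small : ∀ {d e} → d ≤ c → ℓ ≤ e → e + e < d + d + d + 3 → ⊥
    too-small d≤c ℓ≤e lt = <⇒≱ lt (≤-trans (+-monoˡ-≤ 3 (+-mono-≤ (+-mono-≤ d≤c d≤c) d≤c)) (≤-trans 3c+3≤2ℓ (+-mono-≤ ℓ≤e ℓ≤e)))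
    2≁5 : ¬ SameParity 2 5
    2≁5 (inj₁ (_ , even)) = Even⇒¬Odd even (2 , refl)
    2≁5 (inj₂ (odd , _))  = Even⇒¬Odd (1 , refl) odd
    small : ∀ A → A ≤ 3 → ℓ ≤ 2 + A → SameParity c (2 + A) → ⊥
    small 0 _ ℓ≤ _ = too-small 2≤c ℓ≤ (m≤n+m 5 4)
    small 1 _ ℓ≤ _ = too-small 2≤c ℓ≤ (m≤n+m 7 2)
    small 2 _ ℓ≤ _ = too-small 2≤c ℓ≤ ≤-refl
    small 3 _ ℓ≤ par with m≤n⇒m<n∨m≡n 2≤c
    ... | inj₁ 3≤c = too-small 3≤c ℓ≤ (m≤n+m 11 1)
    ... | inj₂ 2≡c = 2≁5 (subst (λ c → SameParity c 5) (sym 2≡c) par)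
    small (suc (suc (suc (suc A)))) (s≤s (s≤s (s≤s ()))) _ _

-- One of 1 + A and 2 + A has the parity of `c`, and it serves as `m` unless it is `c` itself. In
-- that case 2c ≥ ℓ + 2, so `wide` has room, and m = c + 2 again has the right parity.
rainbow-cycle : ∀ {ℓ c} → 2 ≤ c → c + c + c + 3 ≤ ℓ + ℓ → RainbowCycle ℓ (suc c)
rainbow-cycle {0} {c} 2≤c h = ⊥-elim (<⇒≱ (≤-trans (s≤s z≤n) (m≤n+m 3 c)) (c+3≤ℓ 2≤c h))
rainbow-cycle {1} {c} 2≤c h = ⊥-elim (<⇒≱ (≤-trans (s≤s (s≤s z≤n)) (m≤n+m 3 c)) (c+3≤ℓ 2≤c h))
rainbow-cycle {2} {c} 2≤c h = ⊥-elim (<⇒≱ (m≤n+m 3 c) (c+3≤ℓ 2≤c h))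
rainbow-cycle {ℓ@(suc (suc (suc y)))} {c@(suc (suc c′))} 2≤c@(s≤s (s≤s _)) h =
  [ same , different ]′ (same-parity c (suc A))
  where
  A = proj₁ (∃-Half ℓ)
  half-A = proj₂ (∃-Half ℓ)
  c+3≤ = c+3≤ℓ 2≤c h
  open Choices c′ A using (plain; raised; wide)
  1+A≤ℓ : 1 + A ≤ ℓ
  1+A≤ℓ = ≮⇒≥ λ ℓ<1+A → <⇒≱ (s≤s (s≤s z≤n)) (+-cancelˡ-≤ ℓ ℓ 1
    (≤-trans (+-mono-≤ (m<1+n⇒m≤n ℓ<1+A) (m<1+n⇒m≤n ℓ<1+A)) (≤-trans (Half-upper half-A) (≤-reflexive (+-comm 1 ℓ)))))
  2+c≤y : 2 + ℓ ≤ c + c → 2 + c ≤ y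
  2+c≤y le = +-cancelˡ-≤ 3 (2 + c) y (subst (_≤ ℓ) (+-comm c 5) (c+5≤ℓ 2≤c h le))
  widened : ∀ r → 3 + y ≤ r → r ≤ 4 + y → 3 + y + r ≡ suc (ℓ + ℓ) ⊎ 3 + y ≡ r → SameParity c c →
    2 + c ≡ suc (6 + y ∸ (r ∸ A)) → 2 + c ≤ y → RainbowCycle ℓ (suc c)
  widened r lo hi cov par m≡ m≤y = wide half-A r lo hi cov
    (descending (SameParity-+2 par) (<⇒≢ (m≤n⇒m≤1+n ≤-refl)) (s≤s z≤n) (s≤s z≤n) (≤-trans (m≤n+m c 2) m≤y) m≤y) m≡ m≤y
  e : ∀ A → 2 + (A + A) ≡ suc A + suc A
  e = ℕ.solve-∀
  e′ : ∀ y → 3 + y + (4 + y) ≡ suc (3 + y + (3 + y))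
  e′ = ℕ.solve-∀
  same : SameParity c (suc A) → RainbowCycle ℓ (suc c)
  same par with c ≟ suc A
  ... | no  c≢m = plain (descending par c≢m (s≤s z≤n) (s≤s z≤n) (≤-trans (m≤m+n c 3) c+3≤) 1+A≤ℓ) half-A c≢m c+3≤ 1+A≤ℓ
  -- Here c = 1 + A, and r = ℓ + 1 gives m = 1 + (ℓ + 3) - (ℓ + 1) + A = 3 + A.
  ... | yes c≡ = widened (4 + y) (n≤1+n _) ≤-refl (inj₁ (e′ y)) (subst (SameParity c) (sym c≡) par)
    (trans (cong (λ r → 2 + r) c≡) (cong suc (sym (trans
      (m∸[n∸o]≡m∸n+o (6 + y) (m≤n+m (4 + y) 2) (m≤n⇒m≤1+n (Half-≤ half-A))) (cong (_+ A) (m+n∸n≡m 2 (4 + y)))))))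
    (2+c≤y (≤-trans (+-monoʳ-≤ 2 (Half-lower half-A)) (≤-reflexive (trans (e A) (cong₂ _+_ (sym c≡) (sym c≡))))))
  different : SameParity c (2 + A) → RainbowCycle ℓ (suc c)
  different par with c ≟ 2 + A
  ... | no  c≢m = raised (descending par c≢m (s≤s z≤n) (s≤s z≤n) (m<1+n⇒m≤n (<-≤-trans (m<m+n c (s≤s z≤n)) c+3≤)) m≤)
                    half-A c≢m c+3≤ m≤
    where
    m≤ : 2 + A ≤ 2 + y
    m≤ = m<1+n⇒m≤n (3+A≤ℓ 2≤c h A (Half-upper half-A) par)
  -- Here c = 2 + A, and r = ℓ gives m = 1 + (ℓ + 3) - ℓ + A = 4 + A.
  ... | yes c≡ = widened (3 + y) ≤-refl (n≤1+n _) (inj₂ refl) (subst (SameParity c) (sym c≡) par)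
    (trans (cong (λ r → 2 + r) c≡) (cong suc (sym (trans
      (m∸[n∸o]≡m∸n+o (6 + y) (m≤n+m (3 + y) 3) (Half-≤ half-A)) (cong (_+ A) (m+n∸n≡m 3 (3 + y)))))))
    (2+c≤y (≤-trans (≤-trans (+-monoʳ-≤ 2 (Half-lower half-A)) (≤-reflexive (e A)))
      (≤-trans (+-mono-≤ (n≤1+n (suc A)) (n≤1+n (suc A))) (≤-reflexive (cong₂ _+_ (sym c≡) (sym c≡))))))

-- Assembly of the four statements

odd⇒1+2ℓ : ∀ n → n % 2 ≡ 1 → n ≡ suc (n / 2 + n / 2)
odd⇒1+2ℓ n n%2≡1 = trans (m≡m%n+[m/n]*n n 2) (cong₂ _+_ n%2≡1 (e (n / 2)))
  where
  e : ∀ l → l * 2 ≡ l + l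
  e = ℕ.solve-∀

-- The bound n ≥ 4 excludes ℓ ≤ 1, so ⌊ℓ / 2⌋, supplied by `half`, is a positive place for the
-- repeated sign.
two-rainbow-Hamilton-cycles : ∀ {n} ℓ → n ≡ suc (ℓ + ℓ) → 4 ≤ n → ∃₂ λ (C D : List (Subset n)) →
  IsRainbowHamiltonCycle n 2 C × IsRainbowHamiltonCycle n 2 D × EdgeDisjoint C D
two-rainbow-Hamilton-cycles 0 refl (s≤s ())
two-rainbow-Hamilton-cycles 1 refl (s≤s (s≤s (s≤s ())))
two-rainbow-Hamilton-cycles ℓ@(suc (suc p)) refl _ with half ℓ
... | suc j , inj₁ ℓ≡ = Pairs.two-cycles (suc p) (suc j) (s≤s z≤n) (s≤s z≤n)
  (subst (suc j <_) (sym ℓ≡) (m<m+n (suc j) (s≤s z≤n))) (inj₁ (sym ℓ≡))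
... | suc j , inj₂ ℓ≡ = Pairs.two-cycles (suc p) (suc j) (s≤s z≤n) (s≤s z≤n)
  (subst (suc j <_) (sym ℓ≡) (s≤s (m≤m+n (suc j) (suc j)))) (inj₂ (sym ℓ≡))

rainbow-cycle-odd : ∀ {n k} ℓ → n ≡ suc (ℓ + ℓ) → 3 ≤ k → 3 * k < n →
  ∃ λ (C : List (Subset n)) → IsRainbowCycle n k C
rainbow-cycle-odd {k = suc c} ℓ refl (s≤s 2≤c) (s≤s 3k≤2ℓ) =
  rainbow-cycle {ℓ} 2≤c (subst (_≤ ℓ + ℓ) (e c) 3k≤2ℓ)
  where
  e : ∀ c → 3 * suc c ≡ c + c + c + 3
  e = ℕ.solve-∀

theorem15 : (n k : ℕ) → 4 ≤ n → 2 ≤ k → k ≤ n / 2 →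
    ((n % 2 ≡ 0 → ¬ ∃ λ (C : List (Subset n)) → IsRainbowCycle n k C)
    × (n % 2 ≡ 1 → k ≡ 2 → ∃ λ (C : List (Subset n)) → IsRainbowHamiltonCycle n 2 C)
    × (n % 2 ≡ 1 → k ≡ 2 → ∃₂ λ (C D : List (Subset n)) →
    IsRainbowHamiltonCycle n 2 C × IsRainbowHamiltonCycle n 2 D × EdgeDisjoint C D)
    × (n % 2 ≡ 1 → 3 ≤ k → 3 * k < n → ∃ λ (C : List (Subset n)) → IsRainbowCycle n k C))
theorem15 n@(suc n-1) k 4≤n 2≤k k≤n/2 =
    (λ n%2≡0 (C , rainbow) → case trans (sym n%2≡0) (rainbow-cycle⇒odd n-1 k C rainbow) of λ ())
  , (λ n%2≡1 _ → let C , _ , C-rainbow , _ = two n%2≡1 in C , C-rainbow)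
  , (λ n%2≡1 _ → two n%2≡1)
  , (λ n%2≡1 → rainbow-cycle-odd (n / 2) (odd⇒1+2ℓ n n%2≡1))
  where
  two : n % 2 ≡ 1 → ∃₂ λ (C D : List (Subset n)) →
    IsRainbowHamiltonCycle n 2 C × IsRainbowHamiltonCycle n 2 D × EdgeDisjoint C D
  two n%2≡1 = two-rainbow-Hamilton-cycles (n / 2) (odd⇒1+2ℓ n n%2≡1) 4≤n
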